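{- Let $n$ be a positive integer divisible by $6$ and let $b = n/6$. Then every graph on $n$ vertices with at least $n^2/4$ edges and book number at most $b$ which is not the balanced complete bipartite graph has at least $b^2(n-4b)$ triangles, with equality if and only if the graph is (isomorphic to) $S_{b,n}$.
   Context: The book number $b(G)$ of a graph $G$ is the maximum, over all edges $uv$ of $G$, of the number of triangles containing the edge $uv$ (equivalently, the number of common neighbours of $u$ and $v$). The balanced complete bipartite graph on $n$ vertices is the complete bipartite graph with parts of sizes $\lfloor n/2\rfloor$ and $\lceil n/2\rceil$. For nonnegative integers $b \le n/4$, $S_{b,n}$ is the graph on $n$ vertices whose vertex set is partitioned into six parts $U_1,U_2,U_3,V_1,V_2,V_3$ with $|U_1|=|U_2|=|V_1|=|V_2|=b$, $|U_3|=\lfloor (n-4b)/2\rfloor$, $|V_3|=\lceil (n-4b)/2\rceil$, where $U_i$ is complete to $U_j$ for $i\neq j$, $V_i$ is complete to $V_j$ for $i \neq j$, $U_i$ is complete to $V_i$ for each $i$, and there are no other edges. (For $b=n/6$ all six parts have size $n/6$ and $b^2(n-4b)=n^3/108$.) -}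

module Defs where

open import Data.Bool using (Bool; true; false; _∧_; _∨_; not; if_then_else_; _xor_)
open import Data.Nat using (ℕ; zero; suc; _+_; _*_; _∸_; _≤_; _<ᵇ_; _≡ᵇ_; _⊔_; _/_)
open import Data.Fin using (Fin; toℕ)
open import Data.List using (List; map; allFin; foldr)
open import Data.Nat.ListAction using (sum)
open import Data.Product using (Σ; _×_; _,_)
open import Data.Fin.Permutation using (Permutation′; _⟨$⟩ʳ_)
open import Relation.Binary.PropositionalEquality using (_≡_)

Adj : ℕ → Set
Adj n = Fin n → Fin n → Bool

IsSimpleGraph : ∀ {n} → Adj n → Set
IsSimpleGraph {n} adj = (∀ (i j : Fin n) → adj i j ≡ adj j i) × (∀ (i : Fin n) → adj i i ≡ false)

count : ∀ {n} → (Fin n → Bool) → ℕ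
count {n} p = sum (map (λ i → if p i then 1 else 0) (allFin n))

numEdges : ∀ {n} → Adj n → ℕ
numEdges {n} adj =
  sum (map (λ i → count (λ j → (toℕ i <ᵇ toℕ j) ∧ adj i j)) (allFin n))

numTriangles : ∀ {n} → Adj n → ℕ
numTriangles {n} adj =
  sum (map (λ i → sum (map (λ j → count (λ k →
        (toℕ i <ᵇ toℕ j) ∧ (toℕ j <ᵇ toℕ k) ∧ adj i j ∧ adj j k ∧ adj i k))
      (allFin n))) (allFin n))

commonNbrs : ∀ {n} → Adj n → Fin n → Fin n → ℕ
commonNbrs adj u v = count (λ w → adj u w ∧ adj v w)

bookNumber : ∀ {n} → Adj n → ℕ
bookNumber {n} adj =
  foldr _⊔_ 0 (map (λ u → foldr _⊔_ 0 (map (λ v →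
      if adj u v then commonNbrs adj u v else 0) (allFin n))) (allFin n))

Isomorphic : ∀ {n} → Adj n → Adj n → Set
Isomorphic {n} G H = Σ (Permutation′ n) λ π →
  ∀ (i j : Fin n) → G (π ⟨$⟩ʳ i) (π ⟨$⟩ʳ j) ≡ H i j

balancedBipartite : (n : ℕ) → Adj n
balancedBipartite n i j = (toℕ i <ᵇ (n / 2)) xor (toℕ j <ᵇ (n / 2))

-- S_{b,n}: vertex k is assigned a side (true = U, false = V) and an index in {1,2,3}.
-- Order: U1 (b), U2 (b), U3 (⌊(n-4b)/2⌋), V1 (b), V2 (b), V3 (the remaining ⌈(n-4b)/2⌉).
sideS : ℕ → ℕ → ℕ → Bool
sideS b n k = k <ᵇ (2 * b + (n ∸ 4 * b) / 2)

indexS : ℕ → ℕ → ℕ → ℕ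
indexS b n k =
  if k <ᵇ u then idx k else idx (k ∸ u)
  where
    u = 2 * b + (n ∸ 4 * b) / 2
    idx : ℕ → ℕ
    idx m = if m <ᵇ b then 1 else (if m <ᵇ 2 * b then 2 else 3)

S : (b n : ℕ) → Adj n
S b n i j =
  let x = toℕ i ; y = toℕ j
      sameSide = not (sideS b n x xor sideS b n y)
      sameIdx  = indexS b n x ≡ᵇ indexS b n y
  in (sameSide ∧ not sameIdx) ∨ (not sameSide ∧ sameIdx)

{-# OPTIONS --safe #-}
module Submission where

open import Defs
open import Data.Bool using (Bool; true; false; _∧_; _∨_; not; if_then_else_; _xor_)
open import Data.Bool.Properties using (¬-not) renaming (_≟_ to _≟ᵇ_)
open import Data.Fin using (Fin; zero; suc; toℕ; fromℕ<; punchIn)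
open import Data.Fin.Permutation using (Permutation′; _⟨$⟩ʳ_; _⟨$⟩ˡ_; inverseʳ; insert; insert-punchIn)
open import Data.Fin.Properties using (toℕ<n; toℕ-injective)
open import Data.List using (map; allFin; foldr; tabulate)
open import Data.List.Properties using (map-tabulate)
open import Data.Nat using (ℕ; zero; suc; _+_; _*_; _∸_; _≤_; _<_; _/_; _<ᵇ_; _≡ᵇ_; _⊔_; z≤n; s≤s; NonZero; >-nonZero)
open import Data.Nat.Divisibility using (_∣_; divides)
open import Data.Nat.DivMod using (m*n/n≡m)
import Data.Nat.ListAction as List
open import Data.Nat.Properties
open import Data.Nat.Tactic.RingSolver using (solve-∀)
open import Data.Product.Properties using (≡-dec)
open import Data.Product using (Σ; ∃; _×_; _,_; proj₁; proj₂)
open import Data.Sum using (_⊎_; inj₁; inj₂; [_,_]′)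
open import Function using (_∘_; id)
open import Function.Bundles using (_⇔_; mk⇔)
open import Relation.Nullary using (¬_; Dec; yes; no; does; contradiction)
open import Relation.Nullary.Reflects using (ofʸ; ofⁿ)
open import Relation.Binary.Definitions using (DecidableEquality; tri<; tri≈; tri>)
open import Relation.Binary.PropositionalEquality
open import Algebra.Properties.Semiring.Sum +-*-semiring
  using (sum-cong-≗; ∑-distrib-+; ∑-comm; sum-permute; *-distribˡ-sum; *-distribʳ-sum; sum-remove)
  renaming (sum to ∑)

-- Write n = 6b, d for degrees, c(uv) for codegrees and t(v) = Σ_{u ~ v} c(uv), so
-- that Σ t is six times the number of triangles.  Since d(u) + d(v) ≤ n + c(uv) and
-- c ≤ b on edges, summing (b − c)(n + c − d(u) − d(v)) ≥ 0 over the edges, and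
-- d(u) + d(v) + d(w) ≤ n + c(uv) + c(vw) + c(uw) over the triangles, gives
-- Σ d² ≤ 3b Σ d.  With Σ d ≥ n²/2 this forces d = 3b everywhere, and then equality
-- throughout: every edge lies in 0 or b triangles.  By inclusion–exclusion there is
-- no K₄ and every triangle dominates the graph.
--
-- A vertex v in no triangle makes the graph balanced bipartite with sides N(v) and its
-- complement.  Otherwise v lies in a triangle vyz, and the 2b vertices of the disjoint
-- sets N(v) ∩ N(y) and N(v) ∩ N(z) each have codegree b with v, so t(v) ≥ 2b²; summing
-- over v gives the bound.
--
-- If equality holds, no other edge at v lies in a triangle.  Fix a triangle xyz.  Every
-- vertex is adjacent to one or two of x, y, z.  Those adjacent to y and z only have the
-- neighbourhood of x, those adjacent to x only have its complement, and this
-- determines the graph; every class has b vertices, so it is S.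

-- Finite sums over `Fin n`, single and iterated.

∑-mono : ∀ {n} {f g : Fin n → ℕ} → (∀ i → f i ≤ g i) → ∑ f ≤ ∑ g
∑-mono {zero}  f≤g = z≤n
∑-mono {suc n} f≤g = +-mono-≤ (f≤g zero) (∑-mono (f≤g ∘ suc))

∑-const : ∀ n k → ∑ {n} (λ _ → k) ≡ n * k
∑-const zero    k = refl
∑-const (suc n) k = cong (k +_) (∑-const n k)

-- A termwise inequality whose sums compare the other way leaves no slack at any index. Equality
-- cases below are extracted from summed inequalities in this way.
∑-tight : ∀ {n} {f g : Fin n → ℕ} → (∀ i → f i ≤ g i) → ∑ g ≤ ∑ f → ∀ i → f i ≡ g i
∑-tight {suc n} {f} {g} f≤g ∑g≤∑f zero =
  ≤-antisym (f≤g zero)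
    (+-cancelʳ-≤ (∑ (f ∘ suc)) _ _ (≤-trans (+-monoʳ-≤ (g zero) (∑-mono (f≤g ∘ suc))) ∑g≤∑f))
∑-tight {suc n} {f} {g} f≤g ∑g≤∑f (suc i) =
  ∑-tight (f≤g ∘ suc)
    (+-cancelˡ-≤ (f zero) _ _ (≤-trans (+-monoˡ-≤ _ (f≤g zero)) ∑g≤∑f)) i

term≤∑ : ∀ {n} (f : Fin n → ℕ) i → f i ≤ ∑ f
term≤∑ f zero    = m≤m+n _ _
term≤∑ f (suc i) = m≤n⇒m≤o+n (f zero) (term≤∑ (f ∘ suc) i)

∑-positive : ∀ {n} (f : Fin n → ℕ) → 0 < ∑ f → ∃ λ i → 0 < f i
∑-positive {suc n} f 0<∑ with f zero in eq
... | suc k = zero , subst (0 <_) (sym eq) (s≤s z≤n)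
... | zero  = let i , p = ∑-positive (f ∘ suc) 0<∑ in suc i , p

∑₂ : ∀ {m n} → (Fin m → Fin n → ℕ) → ℕ
∑₂ f = ∑ λ i → ∑ (f i)

∑₂-cong : ∀ {m n} {f g : Fin m → Fin n → ℕ} → (∀ i j → f i j ≡ g i j) → ∑₂ f ≡ ∑₂ g
∑₂-cong f≗g = sum-cong-≗ λ i → sum-cong-≗ (f≗g i)

∑₂-mono : ∀ {m n} {f g : Fin m → Fin n → ℕ} → (∀ i j → f i j ≤ g i j) → ∑₂ f ≤ ∑₂ g
∑₂-mono f≤g = ∑-mono λ i → ∑-mono (f≤g i)

∑₂-+ : ∀ {m n} (f g : Fin m → Fin n → ℕ) → ∑₂ (λ i j → f i j + g i j) ≡ ∑₂ f + ∑₂ g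
∑₂-+ f g = trans (sum-cong-≗ λ i → ∑-distrib-+ (f i) (g i)) (∑-distrib-+ (∑ ∘ f) (∑ ∘ g))

∑₂-*ˡ : ∀ {m n} k (f : Fin m → Fin n → ℕ) → ∑₂ (λ i j → k * f i j) ≡ k * ∑₂ f
∑₂-*ˡ k f = trans (sum-cong-≗ λ i → sym (*-distribˡ-sum k (f i))) (sym (*-distribˡ-sum k (∑ ∘ f)))

∑₂-tight : ∀ {m n} {f g : Fin m → Fin n → ℕ} → (∀ i j → f i j ≤ g i j) → ∑₂ g ≤ ∑₂ f → ∀ i j → f i j ≡ g i j
∑₂-tight f≤g ∑g≤∑f i =
  ∑-tight (f≤g i) (≤-reflexive (sym (∑-tight (λ i → ∑-mono (f≤g i)) ∑g≤∑f i)))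

∑₃ : ∀ {l m n} → (Fin l → Fin m → Fin n → ℕ) → ℕ
∑₃ f = ∑ λ i → ∑₂ (f i)

∑₃-cong : ∀ {l m n} {f g : Fin l → Fin m → Fin n → ℕ} → (∀ i j k → f i j k ≡ g i j k) → ∑₃ f ≡ ∑₃ g
∑₃-cong f≗g = sum-cong-≗ λ i → ∑₂-cong (f≗g i)

∑₃-mono : ∀ {l m n} {f g : Fin l → Fin m → Fin n → ℕ} → (∀ i j k → f i j k ≤ g i j k) → ∑₃ f ≤ ∑₃ g
∑₃-mono f≤g = ∑-mono λ i → ∑₂-mono (f≤g i)

∑₃-+ : ∀ {l m n} (f g : Fin l → Fin m → Fin n → ℕ) →
       ∑₃ (λ i j k → f i j k + g i j k) ≡ ∑₃ f + ∑₃ g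
∑₃-+ f g = trans (sum-cong-≗ λ i → ∑₂-+ (f i) (g i)) (∑-distrib-+ (∑₂ ∘ f) (∑₂ ∘ g))

∑₃-swap₁₂ : ∀ {l m n} (f : Fin l → Fin m → Fin n → ℕ) → ∑₃ f ≡ ∑₃ λ j i k → f i j k
∑₃-swap₁₂ f = ∑-comm λ i j → ∑ (f i j)

∑₃-swap₂₃ : ∀ {l m n} (f : Fin l → Fin m → Fin n → ℕ) → ∑₃ f ≡ ∑₃ λ i k j → f i j k
∑₃-swap₂₃ f = sum-cong-≗ λ i → ∑-comm (f i)

sum-map-allFin : ∀ {n} (f : Fin n → ℕ) → List.sum (map f (allFin n)) ≡ ∑ f
sum-map-allFin {n} f = trans (cong List.sum (map-tabulate id f)) (sum-tabulate f)
  where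
  sum-tabulate : ∀ {n} (f : Fin n → ℕ) → List.sum (tabulate f) ≡ ∑ f
  sum-tabulate {zero}  f = refl
  sum-tabulate {suc n} f = cong (f zero +_) (sum-tabulate (f ∘ suc))

-- Indicators, counts and the book number.

𝟙 : Bool → ℕ
𝟙 p = if p then 1 else 0

𝟙-∧ : ∀ p q → 𝟙 (p ∧ q) ≡ 𝟙 p * 𝟙 q
𝟙-∧ false q = refl
𝟙-∧ true  q = sym (+-identityʳ (𝟙 q))

𝟙≤1 : ∀ p → 𝟙 p ≤ 1
𝟙≤1 false = z≤n
𝟙≤1 true  = ≤-refl

𝟙-injective : ∀ {p q} → 𝟙 p ≡ 𝟙 q → p ≡ q
𝟙-injective {false} {false} _ = refl
𝟙-injective {true}  {true}  _ = refl

𝟙-mono : ∀ {p q} → (p ≡ true → q ≡ true) → 𝟙 p ≤ 𝟙 q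
𝟙-mono {false} p⇒q = z≤n
𝟙-mono {true}  p⇒q rewrite p⇒q refl = ≤-refl

count-∑ : ∀ {n} (p : Fin n → Bool) → count p ≡ ∑ (𝟙 ∘ p)
count-∑ p = sum-map-allFin (𝟙 ∘ p)

term≤foldr-⊔ : ∀ {n} (f : Fin n → ℕ) i → f i ≤ foldr _⊔_ 0 (map f (allFin n))
term≤foldr-⊔ {n} f i = subst (f i ≤_) (cong (foldr _⊔_ 0) (sym (map-tabulate id f))) (bound f i)
  where
  bound : ∀ {n} (f : Fin n → ℕ) i → f i ≤ foldr _⊔_ 0 (tabulate f)
  bound f zero    = m≤m⊔n _ _
  bound f (suc i) = m≤n⇒m≤o⊔n (f zero) (bound (f ∘ suc) i)

commonNbrs≤bookNumber : ∀ {n} (G : Adj n) {u v} → G u v ≡ true → commonNbrs G u v ≤ bookNumber G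
commonNbrs≤bookNumber {n} G {u} {v} uv =
  ≤-trans (subst (λ p → commonNbrs G u v ≤ (if p then commonNbrs G u v else 0)) (sym uv) ≤-refl)
    (≤-trans (term≤foldr-⊔ (λ v → if G u v then commonNbrs G u v else 0) v)
      (term≤foldr-⊔ (λ u → foldr _⊔_ 0 (map (λ v → if G u v then commonNbrs G u v else 0) (allFin n))) u))

-- Order tests and quadratic inequalities.

<ᵇ-true : ∀ {m n} → m < n → (m <ᵇ n) ≡ true
<ᵇ-true {m} {n} m<n with m <ᵇ n | <ᵇ-reflects-< m n
... | true  | _       = refl
... | false | ofⁿ m≮n = contradiction m<n m≮n

<ᵇ-false : ∀ {m n} → n ≤ m → (m <ᵇ n) ≡ false
<ᵇ-false {m} {n} n≤m with m <ᵇ n | <ᵇ-reflects-< m n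
... | false | _       = refl
... | true  | ofʸ m<n = contradiction m<n (≤⇒≯ n≤m)

true≢false : ∀ {p} → p ≡ true → ¬ p ≡ false
true≢false refl ()

-- This is (y - x)(w - z) ≥ 0 with the negative terms moved across, so that it can be stated in ℕ.
x≤y∧z≤w⇒yz+xw≤yw+xz : ∀ {x y z w} → x ≤ y → z ≤ w → y * z + x * w ≤ y * w + x * z
x≤y∧z≤w⇒yz+xw≤yw+xz {x} {y} {z} {w} x≤y z≤w
  with k , refl ← m≤n⇒∃[o]m+o≡n x≤y | l , refl ← m≤n⇒∃[o]m+o≡n z≤w =
  subst ((x + k) * z + x * (z + l) ≤_) (sym (expand x k z l)) (m≤m+n _ (k * l))
  where
  expand : ∀ x k z l → (x + k) * (z + l) + x * z ≡ ((x + k) * z + x * (z + l)) + k * l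
  expand = solve-∀

-- The witness is |x - y|, and the identity is the expansion of (x - y)² without subtraction.
square-gap : ∀ x y → ∃ λ k → (x * x + y * y ≡ 2 * y * x + k * k) × (k ≡ 0 → x ≡ y)
square-gap x y with ≤-total x y
... | inj₁ x≤y with k , refl ← m≤n⇒∃[o]m+o≡n x≤y = k , expand x k , λ { refl → sym (+-identityʳ x) }
  where
  expand : ∀ x k → x * x + (x + k) * (x + k) ≡ 2 * (x + k) * x + k * k
  expand = solve-∀
... | inj₂ y≤x with k , refl ← m≤n⇒∃[o]m+o≡n y≤x = k , expand y k , λ { refl → +-identityʳ y }
  where
  expand : ∀ y k → (y + k) * (y + k) + y * y ≡ 2 * y * (y + k) + k * k
  expand = solve-∀

2yx≤x²+y² : ∀ x y → 2 * y * x ≤ x * x + y * y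
2yx≤x²+y² x y with k , eq , _ ← square-gap x y rewrite eq = m≤m+n _ _

2yx≡x²+y²⇒x≡y : ∀ x y → 2 * y * x ≡ x * x + y * y → x ≡ y
2yx≡x²+y²⇒x≡y x y eq with k , eq′ , k≡0⇒ ← square-gap x y =
  k≡0⇒ ([ id , id ]′ (m*n≡0⇒m≡0∨n≡0 k (sym (+-cancelˡ-≡ (2 * y * x) 0 (k * k) (trans (+-identityʳ _) (trans eq eq′))))))

-- Matching two labelled families by the multiplicities of their labels.

𝟙-≡ : ∀ {C : Set} (_≟_ : DecidableEquality C) {x y} → x ≡ y → 𝟙 (does (x ≟ y)) ≡ 1
𝟙-≡ _≟_ {x} {y} x≡y with x ≟ y
... | yes _  = refl
... | no x≢y = contradiction x≡y x≢y

multiplicity : ∀ {n} {C : Set} → DecidableEquality C → (Fin n → C) → C → ℕ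
multiplicity _≟_ f x = ∑ λ i → 𝟙 (does (f i ≟ x))

-- Induction on n: the first index of `g` is sent to some p with the same label under `f`, and
-- deleting both lowers the two multiplicities of each label equally. A one-sided comparison
-- suffices because both families have n members.
rearrangement : ∀ {n} {C : Set} (_≟_ : DecidableEquality C) (f g : Fin n → C) →
  (∀ i → multiplicity _≟_ g (g i) ≤ multiplicity _≟_ f (g i)) →
  Σ (Permutation′ n) λ π → ∀ i → f (π ⟨$⟩ʳ i) ≡ g i
rearrangement {zero}  _≟_ f g g≤f = Data.Fin.Permutation.id , λ ()
rearrangement {suc n} {C} _≟_ f g g≤f
  with ∑-positive (λ i → 𝟙 (does (f i ≟ g zero)))
         (≤-trans (≤-trans (≤-reflexive (sym (𝟙-≡ _≟_ {g zero} refl))) (m≤m+n _ _)) (g≤f zero))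
... | p , 0<𝟙 with f p ≟ g zero
...   | yes fp≡g₀ with rearrangement _≟_ (f ∘ punchIn p) (g ∘ suc) rest
  where
  rest : ∀ i → multiplicity _≟_ (g ∘ suc) (g (suc i)) ≤ multiplicity _≟_ (f ∘ punchIn p) (g (suc i))
  rest i = +-cancelˡ-≤ (𝟙 (does (g zero ≟ g (suc i)))) _ _ (≤-trans (g≤f (suc i)) (≤-reflexive
    (trans (sum-remove {i = p} (λ j → 𝟙 (does (f j ≟ g (suc i)))))
           (cong (λ x → 𝟙 (does (x ≟ g (suc i))) + multiplicity _≟_ (f ∘ punchIn p) (g (suc i))) fp≡g₀))))
...     | π , π-spec = insert zero p π , λ
  { zero    → fp≡g₀
  ; (suc i) → trans (cong f (insert-punchIn zero p π i)) (π-spec i) }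

∑-<ᵇ : ∀ {n m} → m ≤ n → ∑ {n} (λ i → 𝟙 (toℕ i <ᵇ m)) ≡ m
∑-<ᵇ {n} {zero}  _ = trans (∑-const n 0) (*-zeroʳ n)
∑-<ᵇ (s≤s m≤n)     = cong suc (∑-<ᵇ m≤n)

multiplicity-half : ∀ {k n} → n ≡ k + k → (f : Fin n → Bool) → ∑ (𝟙 ∘ f) ≡ k → ∀ p → multiplicity _≟ᵇ_ f p ≡ k
multiplicity-half n≡2k f ∑f≡k true  = trans (sum-cong-≗ λ i → pointwise (f i)) ∑f≡k
  where
  pointwise : ∀ p → 𝟙 (does (p ≟ᵇ true)) ≡ 𝟙 p
  pointwise false = refl
  pointwise true  = refl
multiplicity-half {k} {n} n≡2k f ∑f≡k false = +-cancelʳ-≡ k _ k (begin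
  multiplicity _≟ᵇ_ f false + k                    ≡⟨ cong (multiplicity _≟ᵇ_ f false +_) ∑f≡k ⟨
  multiplicity _≟ᵇ_ f false + ∑ (𝟙 ∘ f)            ≡⟨ ∑-distrib-+ (λ i → 𝟙 (does (f i ≟ᵇ false))) (𝟙 ∘ f) ⟨
  ∑ (λ i → 𝟙 (does (f i ≟ᵇ false)) + 𝟙 (f i))      ≡⟨ sum-cong-≗ (λ i → pointwise (f i)) ⟩
  ∑ {n} (λ _ → 1)                                  ≡⟨ ∑-const n 1 ⟩
  n * 1                                            ≡⟨ *-identityʳ n ⟩
  n                                                ≡⟨ n≡2k ⟩
  k + k                                            ∎)
  where
  open ≡-Reasoning
  pointwise : ∀ p → 𝟙 (does (p ≟ᵇ false)) + 𝟙 p ≡ 1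
  pointwise false = refl
  pointwise true  = refl

-- The parts of S and their layout as consecutive blocks.

-- A part of S: (true , i) is Uᵢ₊₁ and (false , i) is Vᵢ₊₁.
Part : Set
Part = Bool × Fin 3

_≟ₚ_ : DecidableEquality Part
_≟ₚ_ = ≡-dec _≟ᵇ_ Data.Fin._≟_

opposite : Part → Part
opposite (s , i) = not s , i

joined : Part → Part → Bool
joined (s , i) (s′ , i′) = (not (s xor s′) ∧ not (toℕ i ≡ᵇ toℕ i′)) ∨ (not (not (s xor s′)) ∧ (toℕ i ≡ᵇ toℕ i′))

joined-opposite : ∀ p → joined p (opposite p) ≡ true
joined-opposite (true  , zero)           = refl
joined-opposite (true  , suc zero)       = refl
joined-opposite (true  , suc (suc zero)) = refl
joined-opposite (false , zero)           = refl
joined-opposite (false , suc zero)       = refl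
joined-opposite (false , suc (suc zero)) = refl

-- This is what keeps the edges of S between a part and its opposite out of all triangles.
opposite-disjoint : ∀ p q → joined p q ≡ true → ¬ joined (opposite p) q ≡ true
opposite-disjoint (s , i) (s′ , i′) = cases s s′ (toℕ i ≡ᵇ toℕ i′)
  where
  cases : ∀ s s′ e → (not (s xor s′) ∧ not e) ∨ (not (not (s xor s′)) ∧ e) ≡ true →
    ¬ (not (not s xor s′) ∧ not e) ∨ (not (not (not s xor s′)) ∧ e) ≡ true
  cases false false false _ ()
  cases false true  true  _ ()
  cases true  false true  _ ()
  cases true  true  false _ ()

-- Numbers the parts in the order in which `S` lays them out: for n = 6b, part p occupies the
-- positions from `rank p * b` up to but excluding `suc (rank p) * b`.
rank : Part → ℕ
rank (true  , i) = toℕ i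
rank (false , i) = 3 + toℕ i

rank<6 : ∀ p → rank p < 6
rank<6 (true  , i) = m≤n⇒m≤n+o 3 (toℕ<n i)
rank<6 (false , i) = +-monoʳ-< 3 (toℕ<n i)

rank-injective : ∀ p q → rank p ≡ rank q → p ≡ q
rank-injective (true  , i) (true  , j) eq = cong (true ,_) (toℕ-injective eq)
rank-injective (true  , i) (false , j) eq = contradiction (subst (_< 3) eq (toℕ<n i)) (m+n≮m 3 (toℕ j))
rank-injective (false , i) (true  , j) eq = contradiction (subst (_< 3) (sym eq) (toℕ<n j)) (m+n≮m 3 (toℕ i))
rank-injective (false , i) (false , j) eq = cong (false ,_) (toℕ-injective (+-cancelˡ-≡ 3 _ _ eq))

module Parts (b : ℕ) where

  -- Restates the local function `idx` of `indexS`, so that it can be named outside that definition.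
  index : ℕ → ℕ
  index m = if m <ᵇ b then 1 else (if m <ᵇ 2 * b then 2 else 3)

  index-block : ∀ m → m < 3 * b → ∃ λ (i : Fin 3) →
    toℕ i * b ≤ m × m < suc (toℕ i) * b × index m ≡ suc (toℕ i)
  index-block m m<3b with m <ᵇ b | <ᵇ-reflects-< m b | m <ᵇ 2 * b | <ᵇ-reflects-< m (2 * b)
  ... | true  | ofʸ m<b | _     | _        = zero , z≤n , ≤-trans m<b (m≤m+n b 0) , refl
  ... | false | ofⁿ m≮b | true  | ofʸ m<2b = suc zero , ≤-trans (≤-reflexive (+-identityʳ b)) (≮⇒≥ m≮b) , m<2b , refl
  ... | false | _       | false | ofⁿ m≮2b = suc (suc zero) , ≮⇒≥ m≮2b , m<3b , refl

  -- The left side is the cutoff between the two sides in `sideS` and `indexS`; at n = 6b the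
  -- halving in it is exact.
  |U|≡3b : 2 * b + (6 * b ∸ 4 * b) / 2 ≡ 3 * b
  |U|≡3b = begin
    2 * b + (6 * b ∸ 4 * b) / 2   ≡⟨ cong (λ k → 2 * b + k / 2) (*-distribʳ-∸ b 6 4) ⟨
    2 * b + 2 * b / 2             ≡⟨ cong (λ k → 2 * b + k / 2) (*-comm 2 b) ⟩
    2 * b + b * 2 / 2             ≡⟨ cong (2 * b +_) (m*n/n≡m b 2) ⟩
    2 * b + b                     ≡⟨ +-comm (2 * b) b ⟩
    3 * b                         ∎
    where open ≡-Reasoning

  part-block : ∀ k → k < 6 * b → ∃ λ (p : Part) → rank p * b ≤ k × k < suc (rank p) * b
    × sideS b (6 * b) k ≡ proj₁ p × indexS b (6 * b) k ≡ suc (toℕ (proj₂ p))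
  part-block k k<6b rewrite |U|≡3b with k <ᵇ 3 * b | <ᵇ-reflects-< k (3 * b)
  ... | true  | ofʸ k<3b with i , lo , hi , eq ← index-block k k<3b = (true , i) , lo , hi , refl , eq
  ... | false | ofⁿ k≮3b with m , refl ← m≤n⇒∃[o]m+o≡n (≮⇒≥ k≮3b)
      with i , lo , hi , eq ← index-block m (+-cancelˡ-< (3 * b) m (3 * b) (≤-trans k<6b (≤-reflexive (*-distribʳ-+ b 3 3)))) =
    (false , i)
    , ≤-trans (≤-reflexive (*-distribʳ-+ b 3 (toℕ i))) (+-monoʳ-≤ (3 * b) lo)
    , ≤-trans (+-monoʳ-< (3 * b) hi) (≤-reflexive (sym (*-distribʳ-+ b 3 (suc (toℕ i)))))
    , refl
    , trans (cong index (m+n∸m≡n (3 * b) m)) eq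

  part : Fin (6 * b) → Part
  part j = proj₁ (part-block (toℕ j) (toℕ<n j))

  S≡joined : ∀ i j → S b (6 * b) i j ≡ joined (part i) (part j)
  S≡joined i j with part-block (toℕ i) (toℕ<n i) | part-block (toℕ j) (toℕ<n j)
  ... | _ , _ , _ , p , q | _ , _ , _ , p′ , q′ rewrite p | q | p′ | q′ = refl

  -- The positions of part p together with those below its block are exactly the positions below the
  -- next block, so the count is a difference of two initial segments.
  multiplicity-part : ∀ p → multiplicity _≟ₚ_ part p ≡ b
  multiplicity-part p = +-cancelʳ-≡ (rank p * b) _ b (begin
    multiplicity _≟ₚ_ part p + rank p * b
      ≡⟨ cong (multiplicity _≟ₚ_ part p +_) (∑-<ᵇ (*-monoˡ-≤ b (<⇒≤ (rank<6 p)))) ⟨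
    multiplicity _≟ₚ_ part p + ∑ {6 * b} (λ j → 𝟙 (toℕ j <ᵇ rank p * b))
      ≡⟨ ∑-distrib-+ (λ j → 𝟙 (does (part j ≟ₚ p))) (λ j → 𝟙 (toℕ j <ᵇ rank p * b)) ⟨
    ∑ {6 * b} (λ j → 𝟙 (does (part j ≟ₚ p)) + 𝟙 (toℕ j <ᵇ rank p * b))
      ≡⟨ sum-cong-≗ pointwise ⟩
    ∑ {6 * b} (λ j → 𝟙 (toℕ j <ᵇ suc (rank p) * b))
      ≡⟨ ∑-<ᵇ (*-monoˡ-≤ b (rank<6 p)) ⟩
    suc (rank p) * b ∎)
    where
    open ≡-Reasoning
    pointwise : ∀ j → 𝟙 (does (part j ≟ₚ p)) + 𝟙 (toℕ j <ᵇ rank p * b) ≡ 𝟙 (toℕ j <ᵇ suc (rank p) * b)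
    pointwise j with part-block (toℕ j) (toℕ<n j)
    ... | q , lo , hi , _ with q ≟ₚ p
    ...   | yes refl rewrite <ᵇ-false lo | <ᵇ-true hi = refl
    ...   | no q≢p with <-cmp (rank q) (rank p)
    ...     | tri< q<p _ _ rewrite <ᵇ-true (≤-trans hi (*-monoˡ-≤ b q<p))
                                 | <ᵇ-true (≤-trans hi (*-monoˡ-≤ b (m≤n⇒m≤1+n q<p))) = refl
    ...     | tri≈ _ q≡p _ = contradiction (rank-injective q p q≡p) q≢p
    ...     | tri> _ _ p<q rewrite <ᵇ-false (≤-trans (*-monoˡ-≤ b p<q) lo)
                                 | <ᵇ-false (≤-trans (*-monoˡ-≤ b (<⇒≤ p<q)) lo) = refl

-- Ordered counts of edges and triangles.

module Counting {n} (G : Adj n) (simple : IsSimpleGraph G) where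

  G-sym : ∀ {p} u v → G u v ≡ p → G v u ≡ p
  G-sym u v = trans (proj₁ simple v u)

  G-irrefl : ∀ {u v} → G u v ≡ true → ¬ u ≡ v
  G-irrefl {u} uv refl = true≢false uv (proj₂ simple u)

  a : Fin n → Fin n → ℕ
  a u v = 𝟙 (G u v)

  a-sym : ∀ u v → a u v ≡ a v u
  a-sym u v = cong 𝟙 (proj₁ simple u v)

  private
    _≺_ : Fin n → Fin n → ℕ
    u ≺ v = 𝟙 (toℕ u <ᵇ toℕ v)

    data Compare (u v : Fin n) : Set where
      below : toℕ u < toℕ v → u ≺ v ≡ 1 → v ≺ u ≡ 0 → Compare u v
      above : toℕ v < toℕ u → u ≺ v ≡ 0 → v ≺ u ≡ 1 → Compare u v

    compare : ∀ {u v} → ¬ u ≡ v → Compare u v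
    compare {u} {v} u≢v with <-cmp (toℕ u) (toℕ v)
    ... | tri< u<v _ _ = below u<v (cong 𝟙 (<ᵇ-true u<v)) (cong 𝟙 (<ᵇ-false (<⇒≤ u<v)))
    ... | tri≈ _ u≡v _ = contradiction (toℕ-injective u≡v) u≢v
    ... | tri> _ _ v<u = above v<u (cong 𝟙 (<ᵇ-false (<⇒≤ v<u))) (cong 𝟙 (<ᵇ-true v<u))

    two-orders : ∀ {u v} → ¬ u ≡ v → u ≺ v + v ≺ u ≡ 1
    two-orders u≢v with compare u≢v
    ... | below _ p q rewrite p | q = refl
    ... | above _ p q rewrite p | q = refl

    -- Three distinct vertices are increasing in exactly one of their six orderings. The two
    -- contradictory combinations of comparisons are the cyclic ones.
    six-orders : ∀ {u v w} → ¬ u ≡ v → ¬ v ≡ w → ¬ u ≡ w →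
      ((u ≺ v * v ≺ w + u ≺ w * w ≺ v) + (v ≺ u * u ≺ w + v ≺ w * w ≺ u)) + (w ≺ u * u ≺ v + w ≺ v * v ≺ u) ≡ 1
    six-orders u≢v v≢w u≢w with compare u≢v | compare v≢w | compare u≢w
    ... | below _ p p′ | below _ q q′ | below _ r r′ rewrite p | p′ | q | q′ | r | r′ = refl
    ... | below x _ _  | below y _ _  | above z _ _  = contradiction (<-trans x y) (<-asym z)
    ... | below _ p p′ | above _ q q′ | below _ r r′ rewrite p | p′ | q | q′ | r | r′ = refl
    ... | below _ p p′ | above _ q q′ | above _ r r′ rewrite p | p′ | q | q′ | r | r′ = refl
    ... | above _ p p′ | below _ q q′ | below _ r r′ rewrite p | p′ | q | q′ | r | r′ = refl
    ... | above _ p p′ | below _ q q′ | above _ r r′ rewrite p | p′ | q | q′ | r | r′ = refl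
    ... | above x _ _  | above y _ _  | below z _ _  = contradiction (<-trans y x) (<-asym z)
    ... | above _ p p′ | above _ q q′ | above _ r r′ rewrite p | p′ | q | q′ | r | r′ = refl

  ∑a≡2*numEdges : ∑₂ a ≡ 2 * numEdges G
  ∑a≡2*numEdges = begin
    ∑₂ a                                         ≡⟨ ∑₂-cong split ⟩
    ∑₂ (λ u v → e u v + e v u)                   ≡⟨ ∑₂-+ e (λ u v → e v u) ⟩
    ∑₂ e + ∑₂ (λ u v → e v u)                    ≡⟨ cong (∑₂ e +_) (∑-comm (λ u v → e v u)) ⟩
    ∑₂ e + ∑₂ e                                  ≡⟨ double (∑₂ e) ⟩
    2 * ∑₂ e                                     ≡⟨ cong (2 *_) numEdges≡ ⟨
    2 * numEdges G                               ∎
    where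
    open ≡-Reasoning
    eᵇ : Fin n → Fin n → Bool
    eᵇ u v = (toℕ u <ᵇ toℕ v) ∧ G u v
    e : Fin n → Fin n → ℕ
    e u v = 𝟙 (eᵇ u v)
    double : ∀ x → x + x ≡ 2 * x
    double = solve-∀
    numEdges≡ : numEdges G ≡ ∑₂ e
    numEdges≡ = trans (sum-map-allFin (count ∘ eᵇ)) (sum-cong-≗ (count-∑ ∘ eᵇ))
    split : ∀ u v → a u v ≡ e u v + e v u
    split u v = begin
      a u v                               ≡⟨ factor ⟩
      (u ≺ v + v ≺ u) * a u v             ≡⟨ *-distribʳ-+ (a u v) (u ≺ v) (v ≺ u) ⟩
      u ≺ v * a u v + v ≺ u * a u v       ≡⟨ cong₂ _+_ (sym (𝟙-∧ (toℕ u <ᵇ toℕ v) (G u v))) (trans (cong (v ≺ u *_) (a-sym u v)) (sym (𝟙-∧ (toℕ v <ᵇ toℕ u) (G v u)))) ⟩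
      e u v + e v u                       ∎
      where
      factor : a u v ≡ (u ≺ v + v ≺ u) * a u v
      factor with G u v in uv
      ... | false = sym (*-zeroʳ (u ≺ v + v ≺ u))
      ... | true rewrite two-orders (G-irrefl uv) = refl

  triangle : Fin n → Fin n → Fin n → ℕ
  triangle u v w = a u v * (a v w * a u w)

  triangle-swap₁₂ : ∀ u v w → triangle u v w ≡ triangle v u w
  triangle-swap₁₂ u v w = cong₂ _*_ (a-sym u v) (*-comm (a v w) (a u w))

  triangle-swap₂₃ : ∀ u v w → triangle u v w ≡ triangle u w v
  triangle-swap₂₃ u v w rewrite a-sym v w = rearrange (a u v) (a w v) (a u w)
    where
    rearrange : ∀ x y z → x * (y * z) ≡ z * (y * x)
    rearrange = solve-∀

  ∑triangle≡6*numTriangles : ∑₃ triangle ≡ 6 * numTriangles G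
  ∑triangle≡6*numTriangles = begin
    ∑₃ triangle ≡⟨ ∑₃-cong split ⟩
    ∑₃ (λ u v w → ((o u v w + o u w v) + (o v u w + o v w u)) + (o w u v + o w v u))
      ≡⟨ ∑₃-+ (λ u v w → (o u v w + o u w v) + (o v u w + o v w u)) (λ u v w → o w u v + o w v u) ⟩
    ∑₃ (λ u v w → (o u v w + o u w v) + (o v u w + o v w u)) + ∑₃ (λ u v w → o w u v + o w v u)
      ≡⟨ cong₂ _+_ (∑₃-+ (λ u v w → o u v w + o u w v) (λ u v w → o v u w + o v w u))
                   (∑₃-+ (λ u v w → o w u v) (λ u v w → o w v u)) ⟩
    (∑₃ (λ u v w → o u v w + o u w v) + ∑₃ (λ u v w → o v u w + o v w u)) + (∑₃ (λ u v w → o w u v) + ∑₃ (λ u v w → o w v u))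
      ≡⟨ cong (_+ (∑₃ (λ u v w → o w u v) + ∑₃ (λ u v w → o w v u)))
           (cong₂ _+_ (∑₃-+ o (λ u v w → o u w v)) (∑₃-+ (λ u v w → o v u w) (λ u v w → o v w u))) ⟩
    ((∑₃ o + ∑₃ (λ u v w → o u w v)) + (∑₃ (λ u v w → o v u w) + ∑₃ (λ u v w → o v w u))) + (∑₃ (λ u v w → o w u v) + ∑₃ (λ u v w → o w v u))
      ≡⟨ cong₂ _+_ (cong₂ _+_ (cong (∑₃ o +_) s₂) (cong₂ _+_ s₃ s₄)) (cong₂ _+_ s₅ s₆) ⟩
    ((∑₃ o + ∑₃ o) + (∑₃ o + ∑₃ o)) + (∑₃ o + ∑₃ o)
      ≡⟨ six (∑₃ o) ⟩
    6 * ∑₃ o ≡⟨ cong (6 *_) numTriangles≡ ⟨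
    6 * numTriangles G ∎
    where
    open ≡-Reasoning
    oᵇ : Fin n → Fin n → Fin n → Bool
    oᵇ u v w = (toℕ u <ᵇ toℕ v) ∧ (toℕ v <ᵇ toℕ w) ∧ G u v ∧ G v w ∧ G u w
    o : Fin n → Fin n → Fin n → ℕ
    o u v w = 𝟙 (oᵇ u v w)
    six : ∀ x → ((x + x) + (x + x)) + (x + x) ≡ 6 * x
    six = solve-∀
    numTriangles≡ : numTriangles G ≡ ∑₃ o
    numTriangles≡ = trans (sum-map-allFin (λ u → List.sum (map (count ∘ oᵇ u) (allFin n))))
      (sum-cong-≗ λ u → trans (sum-map-allFin (count ∘ oᵇ u)) (sum-cong-≗ (count-∑ ∘ oᵇ u)))
    s₂ : ∑₃ (λ u v w → o u w v) ≡ ∑₃ o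
    s₂ = ∑₃-swap₂₃ (λ u v w → o u w v)
    s₃ : ∑₃ (λ u v w → o v u w) ≡ ∑₃ o
    s₃ = ∑₃-swap₁₂ (λ u v w → o v u w)
    s₄ : ∑₃ (λ u v w → o v w u) ≡ ∑₃ o
    s₄ = trans (∑₃-swap₁₂ (λ u v w → o v w u)) s₂
    s₅ : ∑₃ (λ u v w → o w u v) ≡ ∑₃ o
    s₅ = trans (∑₃-swap₂₃ (λ u v w → o w u v)) s₃
    s₆ : ∑₃ (λ u v w → o w v u) ≡ ∑₃ o
    s₆ = trans (∑₃-swap₂₃ (λ u v w → o w v u)) s₄
    o≡ : ∀ u v w → o u v w ≡ (u ≺ v * v ≺ w) * triangle u v w
    o≡ u v w = begin
      o u v w
        ≡⟨ 𝟙-∧ (toℕ u <ᵇ toℕ v) _ ⟩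
      u ≺ v * 𝟙 ((toℕ v <ᵇ toℕ w) ∧ G u v ∧ G v w ∧ G u w)
        ≡⟨ cong (u ≺ v *_) (𝟙-∧ (toℕ v <ᵇ toℕ w) _) ⟩
      u ≺ v * (v ≺ w * 𝟙 (G u v ∧ G v w ∧ G u w))
        ≡⟨ *-assoc (u ≺ v) (v ≺ w) _ ⟨
      (u ≺ v * v ≺ w) * 𝟙 (G u v ∧ G v w ∧ G u w)
        ≡⟨ cong ((u ≺ v * v ≺ w) *_) (trans (𝟙-∧ (G u v) _) (cong (a u v *_) (𝟙-∧ (G v w) (G u w)))) ⟩
      (u ≺ v * v ≺ w) * triangle u v w ∎
    split : ∀ u v w → triangle u v w ≡ ((o u v w + o u w v) + (o v u w + o v w u)) + (o w u v + o w v u)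
    split u v w = begin
      triangle u v w
        ≡⟨ factor ⟩
      (((x₁ + x₂) + (x₃ + x₄)) + (x₅ + x₆)) * t
        ≡⟨ distribute x₁ x₂ x₃ x₄ x₅ x₆ t ⟩
      ((x₁ * t + x₂ * t) + (x₃ * t + x₄ * t)) + (x₅ * t + x₆ * t)
        ≡⟨ cong₂ _+_ (cong₂ _+_ (cong₂ _+_ (term x₁ (o≡ u v w) refl) (term x₂ (o≡ u w v) t₂))
                                (cong₂ _+_ (term x₃ (o≡ v u w) t₃) (term x₄ (o≡ v w u) t₄)))
                     (cong₂ _+_ (term x₅ (o≡ w u v) t₅) (term x₆ (o≡ w v u) t₆)) ⟩
      ((o u v w + o u w v) + (o v u w + o v w u)) + (o w u v + o w v u) ∎
      where
      t x₁ x₂ x₃ x₄ x₅ x₆ : ℕ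
      t  = triangle u v w
      x₁ = u ≺ v * v ≺ w
      x₂ = u ≺ w * w ≺ v
      x₃ = v ≺ u * u ≺ w
      x₄ = v ≺ w * w ≺ u
      x₅ = w ≺ u * u ≺ v
      x₆ = w ≺ v * v ≺ u
      t₂ : t ≡ triangle u w v
      t₂ = triangle-swap₂₃ u v w
      t₃ : t ≡ triangle v u w
      t₃ = triangle-swap₁₂ u v w
      t₄ : t ≡ triangle v w u
      t₄ = trans t₃ (triangle-swap₂₃ v u w)
      t₅ : t ≡ triangle w u v
      t₅ = trans t₂ (triangle-swap₁₂ u w v)
      t₆ : t ≡ triangle w v u
      t₆ = trans t₅ (triangle-swap₂₃ w u v)
      term : ∀ {x y} z → y ≡ z * x → t ≡ x → z * t ≡ y
      term z y≡ t≡ = trans (cong (z *_) t≡) (sym y≡)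
      distribute : ∀ x₁ x₂ x₃ x₄ x₅ x₆ t → (((x₁ + x₂) + (x₃ + x₄)) + (x₅ + x₆)) * t
        ≡ ((x₁ * t + x₂ * t) + (x₃ * t + x₄ * t)) + (x₅ * t + x₆ * t)
      distribute = solve-∀
      -- Off triangles both sides vanish; on a triangle irreflexivity makes the vertices distinct,
      -- so the six order indicators add up to 1.
      factor : t ≡ (((x₁ + x₂) + (x₃ + x₄)) + (x₅ + x₆)) * t
      factor with G u v in uv | G v w in vw | G u w in uw
      ... | false | _     | _     = sym (*-zeroʳ (((x₁ + x₂) + (x₃ + x₄)) + (x₅ + x₆)))
      ... | true  | false | _     = sym (*-zeroʳ (((x₁ + x₂) + (x₃ + x₄)) + (x₅ + x₆)))
      ... | true  | true  | false = sym (*-zeroʳ (((x₁ + x₂) + (x₃ + x₄)) + (x₅ + x₆)))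
      ... | true  | true  | true  =
        sym (trans (*-identityʳ _) (six-orders (G-irrefl uv) (G-irrefl vw) (G-irrefl uw)))

  -- Degrees, codegrees and inclusion-exclusion.

  d : Fin n → ℕ
  d u = ∑ (a u)

  c : Fin n → Fin n → ℕ
  c u v = ∑ λ w → a u w * a v w

  -- Counts each triangle at u twice, once for each choice of v among its other two vertices.
  t : Fin n → ℕ
  t u = ∑ λ v → a u v * c u v

  commonNbrs≡c : ∀ u v → commonNbrs G u v ≡ c u v
  commonNbrs≡c u v = trans (count-∑ (λ w → G u w ∧ G v w)) (sum-cong-≗ λ w → 𝟙-∧ (G u w) (G v w))

  c-sym : ∀ u v → c u v ≡ c v u
  c-sym u v = sum-cong-≗ λ w → *-comm (a u w) (a v w)

  common-neighbour⇒0<c : ∀ {u v w} → G u w ≡ true → G v w ≡ true → 0 < c u v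
  common-neighbour⇒0<c {u} {v} {w} uw vw =
    ≤-trans (subst₂ (λ p q → 1 ≤ 𝟙 p * 𝟙 q) (sym uw) (sym vw) ≤-refl) (term≤∑ (λ w → a u w * a v w) w)

  0<c⇒common-neighbour : ∀ {u v} → 0 < c u v → ∃ λ w → G u w ≡ true × G v w ≡ true
  0<c⇒common-neighbour {u} {v} 0<c with ∑-positive (λ w → a u w * a v w) 0<c
  ... | w , 0<aa with G u w in uw | G v w in vw
  ...   | true | true = w , uw , vw

  ∑₂-edges : (Fin n → Fin n → ℕ) → ℕ
  ∑₂-edges f = ∑₂ λ u v → a u v * f u v

  ∑₂-edges-+ : ∀ f g → ∑₂-edges (λ u v → f u v + g u v) ≡ ∑₂-edges f + ∑₂-edges g
  ∑₂-edges-+ f g = trans (∑₂-cong λ u v → *-distribˡ-+ (a u v) (f u v) (g u v))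
                         (∑₂-+ (λ u v → a u v * f u v) (λ u v → a u v * g u v))

  ∑₂-edges-*ˡ : ∀ k f → ∑₂-edges (λ u v → k * f u v) ≡ k * ∑₂-edges f
  ∑₂-edges-*ˡ k f = trans (∑₂-cong λ u v → rearrange (a u v) k (f u v)) (∑₂-*ˡ k (λ u v → a u v * f u v))
    where
    rearrange : ∀ x y z → x * (y * z) ≡ y * (x * z)
    rearrange = solve-∀

  ∑₂-edges-flip : ∀ f → ∑₂-edges (λ u v → f v u) ≡ ∑₂-edges f
  ∑₂-edges-flip f = trans (∑-comm (λ u v → a u v * f v u)) (∑₂-cong λ u v → cong (_* f u v) (a-sym v u))

  ∑₃-triangles : (Fin n → Fin n → Fin n → ℕ) → ℕ
  ∑₃-triangles f = ∑₃ λ u v w → triangle u v w * f u v w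

  ∑₃-triangles-+ : ∀ f g → ∑₃-triangles (λ u v w → f u v w + g u v w) ≡ ∑₃-triangles f + ∑₃-triangles g
  ∑₃-triangles-+ f g = trans (∑₃-cong λ u v w → *-distribˡ-+ (triangle u v w) (f u v w) (g u v w))
    (∑₃-+ (λ u v w → triangle u v w * f u v w) (λ u v w → triangle u v w * g u v w))

  ∑₃-triangles-swap₁₂ : ∀ f → ∑₃-triangles (λ u v w → f v u w) ≡ ∑₃-triangles f
  ∑₃-triangles-swap₁₂ f = trans (∑₃-swap₁₂ (λ u v w → triangle u v w * f v u w))
    (∑₃-cong λ u v w → cong (_* f u v w) (triangle-swap₁₂ v u w))

  ∑₃-triangles-swap₂₃ : ∀ f → ∑₃-triangles (λ u v w → f u w v) ≡ ∑₃-triangles f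
  ∑₃-triangles-swap₂₃ f = trans (∑₃-swap₂₃ (λ u v w → triangle u v w * f u w v))
    (∑₃-cong λ u v w → cong (_* f u v w) (triangle-swap₂₃ u w v))

  -- An ordered edge uv extends to a triangle by c(uv) choices of the third vertex, and the weight
  -- does not depend on that choice.
  ∑₃-triangles-on-edges : ∀ (f : Fin n → Fin n → ℕ) → ∑₃-triangles (λ u v _ → f u v) ≡ ∑₂-edges (λ u v → f u v * c u v)
  ∑₃-triangles-on-edges f = ∑₂-cong λ u v → begin
    ∑ (λ w → triangle u v w * f u v)               ≡⟨ sum-cong-≗ (λ w → rearrange (a u v) (a v w) (a u w) (f u v)) ⟩
    ∑ (λ w → a u v * f u v * (a u w * a v w))      ≡⟨ *-distribˡ-sum (a u v * f u v) (λ w → a u w * a v w) ⟨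
    a u v * f u v * c u v                          ≡⟨ *-assoc (a u v) (f u v) (c u v) ⟩
    a u v * (f u v * c u v)                        ∎
    where
    open ≡-Reasoning
    rearrange : ∀ x y z f → x * (y * z) * f ≡ x * f * (z * y)
    rearrange = solve-∀

  ∑t≡6*numTriangles : ∑ t ≡ 6 * numTriangles G
  ∑t≡6*numTriangles = begin
    ∑ t                          ≡⟨ ∑₂-cong (λ u v → cong (a u v *_) (sym (*-identityˡ (c u v)))) ⟩
    ∑₂-edges (λ u v → 1 * c u v) ≡⟨ ∑₃-triangles-on-edges (λ _ _ → 1) ⟨
    ∑₃-triangles (λ _ _ _ → 1)   ≡⟨ ∑₃-cong (λ u v w → *-identityʳ (triangle u v w)) ⟩
    ∑₃ triangle                  ≡⟨ ∑triangle≡6*numTriangles ⟩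
    6 * numTriangles G           ∎
    where open ≡-Reasoning

  ∑1≡n : ∑ {n} (λ _ → 1) ≡ n
  ∑1≡n = trans (∑-const n 1) (*-identityʳ n)

  d+d≤n+c : ∀ u v → d u + d v ≤ n + c u v
  d+d≤n+c u v = begin
    d u + d v                         ≡⟨ ∑-distrib-+ (a u) (a v) ⟨
    ∑ (λ w → a u w + a v w)           ≤⟨ ∑-mono (λ w → pointwise (G u w) (G v w)) ⟩
    ∑ (λ w → 1 + a u w * a v w)       ≡⟨ ∑-distrib-+ (λ _ → 1) (λ w → a u w * a v w) ⟩
    ∑ {n} (λ _ → 1) + c u v           ≡⟨ cong (_+ c u v) ∑1≡n ⟩
    n + c u v                         ∎
    where
    open ≤-Reasoning
    pointwise : ∀ p q → 𝟙 p + 𝟙 q ≤ 1 + 𝟙 p * 𝟙 q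
    pointwise false q     = 𝟙≤1 q
    pointwise true  false = ≤-refl
    pointwise true  true  = ≤-refl

  missed : Fin n → Fin n → Fin n → ℕ
  missed u v w = ∑ λ x → 𝟙 (not (G u x ∨ G v x ∨ G w x))

  shared : Fin n → Fin n → Fin n → ℕ
  shared u v w = ∑ λ x → a u x * (a v x * a w x)

  -- Checked vertex by vertex on the eight membership patterns. `missed` and `shared` record the
  -- exact slack in d(u) + d(v) + d(w) ≤ n + c(uv) + c(vw) + c(uw), so both must vanish wherever
  -- that bound is attained.
  inclusion-exclusion : ∀ u v w →
    (d u + (d v + d w)) + (missed u v w + shared u v w) ≡ n + (c u v + (c v w + c u w))
  inclusion-exclusion u v w = begin
    (d u + (d v + d w)) + (missed u v w + shared u v w)
      ≡⟨ cong₂ _+_ (∑-distrib₃ (a u) (a v) (a w)) (sym (∑-distrib-+ (λ x → 𝟙 (not (G u x ∨ G v x ∨ G w x))) (λ x → a u x * (a v x * a w x)))) ⟩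
    ∑ (λ x → a u x + (a v x + a w x)) + ∑ (λ x → 𝟙 (not (G u x ∨ G v x ∨ G w x)) + a u x * (a v x * a w x))
      ≡⟨ ∑-distrib-+ (λ x → a u x + (a v x + a w x)) (λ x → 𝟙 (not (G u x ∨ G v x ∨ G w x)) + a u x * (a v x * a w x)) ⟨
    ∑ (λ x → (a u x + (a v x + a w x)) + (𝟙 (not (G u x ∨ G v x ∨ G w x)) + a u x * (a v x * a w x)))
      ≡⟨ sum-cong-≗ (λ x → pointwise (G u x) (G v x) (G w x)) ⟩
    ∑ (λ x → 1 + (a u x * a v x + (a v x * a w x + a u x * a w x)))
      ≡⟨ ∑-distrib-+ (λ _ → 1) (λ x → a u x * a v x + (a v x * a w x + a u x * a w x)) ⟩
    ∑ {n} (λ _ → 1) + ∑ (λ x → a u x * a v x + (a v x * a w x + a u x * a w x))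
      ≡⟨ cong₂ _+_ ∑1≡n (sym (∑-distrib₃ (λ x → a u x * a v x) (λ x → a v x * a w x) (λ x → a u x * a w x))) ⟩
    n + (c u v + (c v w + c u w)) ∎
    where
    open ≡-Reasoning
    ∑-distrib₃ : ∀ (f g h : Fin n → ℕ) → ∑ f + (∑ g + ∑ h) ≡ ∑ (λ x → f x + (g x + h x))
    ∑-distrib₃ f g h = sym (trans (∑-distrib-+ f (λ x → g x + h x)) (cong (∑ f +_) (∑-distrib-+ g h)))
    pointwise : ∀ p q r → (𝟙 p + (𝟙 q + 𝟙 r)) + (𝟙 (not (p ∨ q ∨ r)) + 𝟙 p * (𝟙 q * 𝟙 r))
      ≡ 1 + (𝟙 p * 𝟙 q + (𝟙 q * 𝟙 r + 𝟙 p * 𝟙 r))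
    pointwise false false false = refl
    pointwise false false true  = refl
    pointwise false true  false = refl
    pointwise false true  true  = refl
    pointwise true  false false = refl
    pointwise true  false true  = refl
    pointwise true  true  false = refl
    pointwise true  true  true  = refl

-- Regularity, and codegrees 0 or b on edges.

module Extremal (b : ℕ) (0<b : 0 < b) (G : Adj (6 * b)) (simple : IsSimpleGraph G)
  (dense : 6 * b * (6 * b) ≤ 4 * numEdges G) (book : bookNumber G ≤ b) where

  open Counting G simple public

  private
    n : ℕ
    n = 6 * b

    instance
      b≢0 : NonZero b
      b≢0 = >-nonZero 0<b

  c≤b : ∀ {u v} → G u v ≡ true → c u v ≤ b
  c≤b {u} {v} uv = ≤-trans (≤-reflexive (sym (commonNbrs≡c u v))) (≤-trans (commonNbrs≤bookNumber G uv) book)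

  private
    -- `D` is twice the number of edges and `T` six times the number of triangles. `S₂` and `P`
    -- arise as the sums of d(u) and of d(u)c(uv) over ordered edges uv.
    D T S₂ P Q : ℕ
    D  = ∑ d
    T  = ∑ t
    S₂ = ∑ λ u → d u * d u
    P  = ∑ λ u → d u * t u
    Q  = ∑₂-edges λ u v → c u v * c u v

    ∑₂-edges-n : ∑₂-edges (λ _ _ → n) ≡ n * D
    ∑₂-edges-n = trans (∑₂-cong λ u v → *-comm (a u v) n) (∑₂-*ˡ n a)

    ∑₂-edges-d : ∑₂-edges (λ u _ → d u) ≡ S₂
    ∑₂-edges-d = sum-cong-≗ λ u → sym (*-distribʳ-sum (d u) (a u))

    ∑₂-edges-dc : ∑₂-edges (λ u v → d u * c u v) ≡ P
    ∑₂-edges-dc = sum-cong-≗ λ u → trans (sum-cong-≗ λ v → rearrange (a u v) (d u) (c u v))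
                                         (sym (*-distribˡ-sum (d u) (λ v → a u v * c u v)))
      where
      rearrange : ∀ x y z → x * (y * z) ≡ y * (x * z)
      rearrange = solve-∀

    -- The sum over all edges uv of (b − c)(n + c − d u − d v) ≥ 0, where c = c u v.
    edge-inequality : b * (S₂ + S₂) + (n * T + Q) ≤ b * (n * D + T) + (P + P)
    edge-inequality = begin
      b * (S₂ + S₂) + (n * T + Q)
        ≡⟨ left ⟨
      ∑₂-edges (λ u v → b * (d u + d v) + (n * c u v + c u v * c u v))
        ≤⟨ ∑₂-mono pointwise ⟩
      ∑₂-edges (λ u v → b * (n + c u v) + (d u * c u v + d v * c u v))
        ≡⟨ right ⟩
      b * (n * D + T) + (P + P) ∎
      where
      open ≤-Reasoning
      pointwise : ∀ u v → a u v * (b * (d u + d v) + (n * c u v + c u v * c u v))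
                        ≤ a u v * (b * (n + c u v) + (d u * c u v + d v * c u v))
      pointwise u v with G u v in uv
      ... | false = z≤n
      ... | true  = +-monoˡ-≤ 0 (subst₂ _≤_ (cong (b * (d u + d v) +_) (e₁ (c u v) n))
                                            (cong (b * (n + c u v) +_) (e₂ (c u v) (d u) (d v)))
                                   (x≤y∧z≤w⇒yz+xw≤yw+xz (c≤b uv) (d+d≤n+c u v)))
        where
        e₁ : ∀ c n → c * (n + c) ≡ n * c + c * c
        e₁ = solve-∀
        e₂ : ∀ c x y → c * (x + y) ≡ x * c + y * c
        e₂ = solve-∀
      left : ∑₂-edges (λ u v → b * (d u + d v) + (n * c u v + c u v * c u v)) ≡ b * (S₂ + S₂) + (n * T + Q)
      left = trans (∑₂-edges-+ (λ u v → b * (d u + d v)) (λ u v → n * c u v + c u v * c u v)) (cong₂ _+_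
        (trans (∑₂-edges-*ˡ b (λ u v → d u + d v)) (cong (b *_)
          (trans (∑₂-edges-+ (λ u _ → d u) (λ _ v → d v))
                 (cong₂ _+_ ∑₂-edges-d (trans (∑₂-edges-flip (λ u _ → d u)) ∑₂-edges-d)))))
        (trans (∑₂-edges-+ (λ u v → n * c u v) (λ u v → c u v * c u v)) (cong (_+ Q) (∑₂-edges-*ˡ n c))))
      right : ∑₂-edges (λ u v → b * (n + c u v) + (d u * c u v + d v * c u v)) ≡ b * (n * D + T) + (P + P)
      right = trans (∑₂-edges-+ (λ u v → b * (n + c u v)) (λ u v → d u * c u v + d v * c u v)) (cong₂ _+_
        (trans (∑₂-edges-*ˡ b (λ u v → n + c u v)) (cong (b *_)
          (trans (∑₂-edges-+ (λ _ _ → n) c) (cong (_+ T) ∑₂-edges-n))))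
        (trans (∑₂-edges-+ (λ u v → d u * c u v) (λ u v → d v * c u v)) (cong₂ _+_ ∑₂-edges-dc
          (trans (∑₂-cong λ u v → cong (λ x → a u v * (d v * x)) (c-sym u v))
            (trans (∑₂-edges-flip (λ u v → d u * c u v)) ∑₂-edges-dc)))))

    -- The sum over all triangles uvw of |N u ∪ N v ∪ N w| ≤ n.
    triangle-inequality : P + (P + P) ≤ n * T + (Q + (Q + Q))
    triangle-inequality = begin
      P + (P + P)
        ≡⟨ left ⟨
      ∑₃-triangles (λ u v w → d u + (d v + d w))
        ≤⟨ ∑₃-mono (λ u v w → *-monoʳ-≤ (triangle u v w) (≤-trans (m≤m+n _ _) (≤-reflexive (inclusion-exclusion u v w)))) ⟩
      ∑₃-triangles (λ u v w → n + (c u v + (c v w + c u w)))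
        ≡⟨ right ⟩
      n * T + (Q + (Q + Q)) ∎
      where
      open ≤-Reasoning
      d₁ : ∑₃-triangles (λ u v w → d u) ≡ P
      d₁ = trans (∑₃-triangles-on-edges (λ u _ → d u)) ∑₂-edges-dc
      d₂ : ∑₃-triangles (λ u v w → d v) ≡ P
      d₂ = trans (∑₃-triangles-swap₁₂ (λ u v w → d u)) d₁
      d₃ : ∑₃-triangles (λ u v w → d w) ≡ P
      d₃ = trans (∑₃-triangles-swap₂₃ (λ u v w → d v)) d₂
      c₁ : ∑₃-triangles (λ u v w → c u v) ≡ Q
      c₁ = ∑₃-triangles-on-edges c
      c₂ : ∑₃-triangles (λ u v w → c u w) ≡ Q
      c₂ = trans (∑₃-triangles-swap₂₃ (λ u v w → c u v)) c₁
      c₃ : ∑₃-triangles (λ u v w → c v w) ≡ Q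
      c₃ = trans (∑₃-triangles-swap₁₂ (λ u v w → c u w)) c₂
      left : ∑₃-triangles (λ u v w → d u + (d v + d w)) ≡ P + (P + P)
      left = trans (∑₃-triangles-+ (λ u v w → d u) (λ u v w → d v + d w)) (cong₂ _+_ d₁
        (trans (∑₃-triangles-+ (λ u v w → d v) (λ u v w → d w)) (cong₂ _+_ d₂ d₃)))
      right : ∑₃-triangles (λ u v w → n + (c u v + (c v w + c u w))) ≡ n * T + (Q + (Q + Q))
      right = trans (∑₃-triangles-+ (λ u v w → n) (λ u v w → c u v + (c v w + c u w))) (cong₂ _+_
        (trans (∑₃-triangles-on-edges (λ _ _ → n)) (∑₂-edges-*ˡ n c))
        (trans (∑₃-triangles-+ (λ u v w → c u v) (λ u v w → c v w + c u w)) (cong₂ _+_ c₁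
          (trans (∑₃-triangles-+ (λ u v w → c v w) (λ u v w → c u w)) (cong₂ _+_ c₃ c₂)))))

    c²≤bc : ∀ u v → a u v * (c u v * c u v) ≤ a u v * (b * c u v)
    c²≤bc u v with G u v in uv
    ... | false = z≤n
    ... | true  = +-monoˡ-≤ 0 (*-monoˡ-≤ (c u v) (c≤b uv))

    Q≤bT : Q ≤ b * T
    Q≤bT = ≤-trans (∑₂-mono c²≤bc) (≤-reflexive (∑₂-edges-*ˡ b c))

    -- Weights 3 and 2 on the edge and triangle inequalities cancel `P`. What remains of `T` and `Q`
    -- is three times `Q≤bT`, and adding that leaves only `S₂` and `D`.
    S₂≤3bD : S₂ ≤ 3 * b * D
    S₂≤3bD = *-cancelˡ-≤ (6 * b) {{m*n≢0 6 b}} (+-cancelʳ-≤ (18 * b * T + 6 * Q + 6 * P) _ _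
      (subst₂ _≤_ (lhs b T S₂ P Q) (rhs b D T P Q)
        (+-mono-≤ (*-monoʳ-≤ 3 edge-inequality) (+-mono-≤ (*-monoʳ-≤ 2 triangle-inequality) (*-monoʳ-≤ 3 Q≤bT)))))
      where
      lhs : ∀ b T S₂ P Q → 3 * (b * (S₂ + S₂) + (6 * b * T + Q)) + (2 * (P + (P + P)) + 3 * Q)
          ≡ 6 * b * S₂ + (18 * b * T + 6 * Q + 6 * P)
      lhs = solve-∀
      rhs : ∀ b D T P Q → 3 * (b * (6 * b * D + T) + (P + P)) + (2 * (6 * b * T + (Q + (Q + Q))) + 3 * (b * T))
          ≡ 6 * b * (3 * b * D) + (18 * b * T + 6 * Q + 6 * P)
      rhs = solve-∀

    -- The constant is n²/2 at n = 6b, and `D` is twice the number of edges.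
    18b²≤D : 18 * (b * b) ≤ D
    18b²≤D = *-cancelˡ-≤ 2 (subst₂ _≤_ (lhs b) (trans (rhs (numEdges G)) (cong (2 *_) (sym ∑a≡2*numEdges))) dense)
      where
      lhs : ∀ b → 6 * b * (6 * b) ≡ 2 * (18 * (b * b))
      lhs = solve-∀
      rhs : ∀ e → 4 * e ≡ 2 * (2 * e)
      rhs = solve-∀

  -- The sum of (d(u) - 3b)² is `S₂` + 54b³ - 6b`D`. The two preceding bounds make `S₂` and 54b³ at
  -- most 3b`D` each, so every square vanishes.
  d≡3b : ∀ u → d u ≡ 3 * b
  d≡3b u = 2yx≡x²+y²⇒x≡y (d u) (3 * b)
    (∑-tight {f = λ u → 2 * (3 * b) * d u} {g = λ u → d u * d u + 3 * b * (3 * b)} (λ u → 2yx≤x²+y² (d u) (3 * b)) (begin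
      ∑ (λ u → d u * d u + 3 * b * (3 * b))     ≡⟨ ∑-distrib-+ (λ u → d u * d u) (λ _ → 3 * b * (3 * b)) ⟩
      S₂ + ∑ {n} (λ _ → 3 * b * (3 * b))        ≡⟨ cong (S₂ +_) (trans (∑-const n _) (cube b)) ⟩
      S₂ + 3 * b * (18 * (b * b))               ≤⟨ +-mono-≤ S₂≤3bD (*-monoʳ-≤ (3 * b) 18b²≤D) ⟩
      3 * b * D + 3 * b * D                     ≡⟨ double b D ⟩
      2 * (3 * b) * D                           ≡⟨ *-distribˡ-sum (2 * (3 * b)) d ⟩
      ∑ (λ u → 2 * (3 * b) * d u)               ∎) u)
    where
    open ≤-Reasoning
    cube : ∀ b → 6 * b * (3 * b * (3 * b)) ≡ 3 * b * (18 * (b * b))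
    cube = solve-∀
    double : ∀ b D → 3 * b * D + 3 * b * D ≡ 2 * (3 * b) * D
    double = solve-∀

  private
    S₂≡3bD : S₂ ≡ 3 * b * D
    S₂≡3bD = trans (sum-cong-≗ λ u → cong (_* d u) (d≡3b u)) (sym (*-distribˡ-sum (3 * b) d))

    -- Now that `S₂` equals 3b`D`, the same combination of the edge and triangle inequalities, taken
    -- without `Q≤bT`, yields the reverse of `Q≤bT`.
    bT≤Q : b * T ≤ Q
    bT≤Q = *-cancelˡ-≤ 3 (+-cancelˡ-≤ (15 * b * T + 6 * b * S₂ + 3 * Q + 6 * P) _ _
      (subst₂ _≤_ (lhs b T S₂ P Q) (trans (cong (λ x → 6 * b * x + (15 * b * T + 6 * Q + 6 * P)) (sym S₂≡3bD)) (reorder b T S₂ P Q))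
        (≤-trans (+-mono-≤ (*-monoʳ-≤ 3 edge-inequality) (*-monoʳ-≤ 2 triangle-inequality)) (≤-reflexive (rhs b D T P Q)))))
      where
      lhs : ∀ b T S₂ P Q → 3 * (b * (S₂ + S₂) + (6 * b * T + Q)) + 2 * (P + (P + P))
          ≡ (15 * b * T + 6 * b * S₂ + 3 * Q + 6 * P) + 3 * (b * T)
      lhs = solve-∀
      rhs : ∀ b D T P Q → 3 * (b * (6 * b * D + T) + (P + P)) + 2 * (6 * b * T + (Q + (Q + Q)))
          ≡ 6 * b * (3 * b * D) + (15 * b * T + 6 * Q + 6 * P)
      rhs = solve-∀
      reorder : ∀ b T S₂ P Q → 6 * b * S₂ + (15 * b * T + 6 * Q + 6 * P) ≡ (15 * b * T + 6 * b * S₂ + 3 * Q + 6 * P) + 3 * Q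
      reorder = solve-∀

  -- Since `Q` = b`T`, every edge satisfies c² = bc; the common neighbour w makes c positive, so c
  -- cancels.
  triangle⇒c≡b : ∀ {u v w} → G u v ≡ true → G u w ≡ true → G v w ≡ true → c u v ≡ b
  triangle⇒c≡b {u} {v} uv uw vw = *-cancelʳ-≡ (c u v) b (c u v) {{>-nonZero (common-neighbour⇒0<c uw vw)}}
    (subst (λ p → 𝟙 p * (c u v * c u v) ≡ 𝟙 p * (b * c u v) → c u v * c u v ≡ b * c u v) (sym uv)
      (λ eq → trans (sym (+-identityʳ _)) (trans eq (+-identityʳ _)))
      (∑₂-tight c²≤bc (≤-trans (≤-reflexive (∑₂-edges-*ˡ b c)) bT≤Q) u v))

  -- Neighbourhoods of triangles, and of pairs of vertices.

  _~_ : Fin n → Fin n → Set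
  u ~ v = G u v ≡ true

  ~-sym : ∀ {u v} → u ~ v → v ~ u
  ~-sym {u} {v} = G-sym u v

  record Triangle (u v w : Fin n) : Set where
    constructor ⟨_,_,_⟩
    field
      uv : u ~ v
      uw : u ~ w
      vw : v ~ w

  private
    -- Degrees 3b and codegrees b give 9b = 6b + 3b, which saturates inclusion-exclusion.
    missed+shared≡0 : ∀ {u v w} → Triangle u v w → missed u v w + shared u v w ≡ 0
    missed+shared≡0 {u} {v} {w} ⟨ uv , uw , vw ⟩ = +-cancelˡ-≡ (d u + (d v + d w)) _ 0 (begin
      (d u + (d v + d w)) + (missed u v w + shared u v w)
        ≡⟨ inclusion-exclusion u v w ⟩
      6 * b + (c u v + (c v w + c u w))
        ≡⟨ cong (6 * b +_) (cong₂ _+_ (triangle⇒c≡b uv uw vw)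
             (cong₂ _+_ (triangle⇒c≡b vw (~-sym uv) (~-sym uw)) (triangle⇒c≡b uw uv (~-sym vw)))) ⟩
      6 * b + (b + (b + b))
        ≡⟨ nine b ⟩
      (3 * b + (3 * b + 3 * b)) + 0
        ≡⟨ cong (_+ 0) (cong₂ _+_ (d≡3b u) (cong₂ _+_ (d≡3b v) (d≡3b w))) ⟨
      (d u + (d v + d w)) + 0 ∎)
      where
      open ≡-Reasoning
      nine : ∀ b → 6 * b + (b + (b + b)) ≡ (3 * b + (3 * b + 3 * b)) + 0
      nine = solve-∀

  -- Such an x would be counted by `shared`, which vanishes on triangles.
  no-K₄ : ∀ {u v w x} → Triangle u v w → u ~ x → v ~ x → ¬ w ~ x
  no-K₄ {u} {v} {w} {x} tri ux vx wx = contradiction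
    (≤-trans (term≤∑ (λ x → a u x * (a v x * a w x)) x) (≤-reflexive (m+n≡0⇒n≡0 (missed u v w) (missed+shared≡0 tri))))
    (subst (λ k → ¬ k ≤ 0) (sym (cong₂ _*_ (cong 𝟙 ux) (cong₂ _*_ (cong 𝟙 vx) (cong 𝟙 wx)))) λ ())

  triangle-dominates : ∀ {u v w} → Triangle u v w → ∀ x → u ~ x ⊎ v ~ x ⊎ w ~ x
  triangle-dominates {u} {v} {w} tri x = cases (G u x) (G v x) (G w x)
    (≤-trans (term≤∑ (λ x → 𝟙 (not (G u x ∨ G v x ∨ G w x))) x)
             (≤-reflexive (m+n≡0⇒m≡0 (missed u v w) (missed+shared≡0 tri))))
    where
    cases : ∀ p q r → 𝟙 (not (p ∨ q ∨ r)) ≤ 0 → p ≡ true ⊎ q ≡ true ⊎ r ≡ true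
    cases true  _     _    _ = inj₁ refl
    cases false true  _    _ = inj₂ (inj₁ refl)
    cases false false true _ = inj₂ (inj₂ refl)

  -- Both neighbourhoods have 3b vertices, so inclusion is equality.
  nested⇒twins : ∀ {x y} → (∀ w → x ~ w → y ~ w) → ∀ w → G x w ≡ G y w
  nested⇒twins {x} {y} x⊆y w = 𝟙-injective
    (∑-tight {f = a x} {g = a y} (λ w → 𝟙-mono (x⊆y w)) (≤-reflexive (trans (d≡3b y) (sym (d≡3b x)))) w)

  -- Two disjoint sets of 3b vertices exhaust all 6b.
  disjoint⇒complementary : ∀ {x y} → (∀ w → x ~ w → ¬ y ~ w) → ∀ w → G y w ≡ not (G x w)
  disjoint⇒complementary {x} {y} disjoint w = complement (G x w) (G y w)
    (∑-tight {f = λ w → a x w + a y w} {g = λ _ → 1} (λ w → pointwise (G x w) (G y w) (disjoint w)) ∑1≤ w)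
    where
    pointwise : ∀ p q → (p ≡ true → ¬ q ≡ true) → 𝟙 p + 𝟙 q ≤ 1
    pointwise false q     _ = 𝟙≤1 q
    pointwise true  false _ = ≤-refl
    pointwise true  true  h = contradiction refl (h refl)
    complement : ∀ p q → 𝟙 p + 𝟙 q ≡ 1 → q ≡ not p
    complement false true  _ = refl
    complement true  false _ = refl
    halves : ∀ b → 6 * b ≡ 3 * b + 3 * b
    halves = solve-∀
    ∑1≤ : ∑ {n} (λ _ → 1) ≤ ∑ (λ w → a x w + a y w)
    ∑1≤ = ≤-reflexive (trans ∑1≡n (trans (halves b)
      (sym (trans (∑-distrib-+ (a x) (a y)) (cong₂ _+_ (d≡3b x) (d≡3b y))))))

  -- The bipartite alternative and the lower bound on triangles.

  bipartite-from : ∀ v → (∀ {u w} → ¬ Triangle v u w) → ∀ u w → G u w ≡ G v u xor G v w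
  bipartite-from v none u w with G v u in vu
  ... | true  = disjoint⇒complementary (λ w vw uw → none ⟨ vu , vw , uw ⟩) w
  ... | false = sym (nested⇒twins v⊆u w)
    where
    -- A neighbour w of v has the complement of N(v) as its neighbourhood, and u lies in that
    -- complement.
    v⊆u : ∀ w → v ~ w → u ~ w
    v⊆u w vw = ~-sym (trans (disjoint⇒complementary (λ x vx wx → none ⟨ vw , vx , wx ⟩) u) (cong not vu))

  triangle-or-bipartite : ∀ v → (∃ λ u → ∃ λ w → Triangle v u w) ⊎ (∀ u w → G u w ≡ G v u xor G v w)
  triangle-or-bipartite v with t v in tv
  ... | zero = inj₂ (bipartite-from v λ { {u} ⟨ vu , vw , uw ⟩ → contradiction
          (≤-trans (subst (λ p → 1 ≤ 𝟙 p * c v u) (sym vu) (≤-trans (common-neighbour⇒0<c vw uw) (m≤m+n _ 0)))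
                   (≤-trans (term≤∑ (λ u → a v u * c v u) u) (≤-reflexive tv))) λ () })
  ... | suc _ with ∑-positive (λ u → a v u * c v u) (subst (0 <_) (sym tv) (s≤s z≤n))
  ...   | u , 0<ac with G v u in vu
  ...     | true with w , vw , uw ← 0<c⇒common-neighbour {v} {u} (subst (0 <_) (+-identityʳ _) 0<ac) =
    inj₁ (u , w , ⟨ vu , vw , uw ⟩)

  private
    -- By the absence of K₄, no neighbour of v is adjacent to both y and z.
    link-bound : ∀ {v y z} → Triangle v y z → ∀ u → b * (a v u * a y u) + b * (a v u * a z u) ≤ a v u * c v u
    link-bound {v} {y} {z} tri@(⟨ vy , vz , _ ⟩) u = cases (G v u) (G y u) (G z u) (c v u)
      (λ vu yu → triangle⇒c≡b vu vy (~-sym yu)) (λ vu zu → triangle⇒c≡b vu vz (~-sym zu)) (no-K₄ tri)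
      where
      unitˡ : ∀ b → b * 1 + b * 0 ≡ b + 0
      unitˡ = solve-∀
      unitʳ : ∀ b → b * 0 + b * 1 ≡ b + 0
      unitʳ = solve-∀
      cases : ∀ p q r k → (p ≡ true → q ≡ true → k ≡ b) → (p ≡ true → r ≡ true → k ≡ b) →
        (p ≡ true → q ≡ true → ¬ r ≡ true) → b * (𝟙 p * 𝟙 q) + b * (𝟙 p * 𝟙 r) ≤ 𝟙 p * k
      cases false _     _     _ _ _ _ rewrite *-zeroʳ b = z≤n
      cases true  true  true  _ _ _ h = contradiction refl (h refl refl)
      cases true  true  false _ h _ _ rewrite h refl refl = ≤-reflexive (unitˡ b)
      cases true  false true  _ _ h _ rewrite h refl refl = ≤-reflexive (unitʳ b)
      cases true  false false _ _ _ _ rewrite *-zeroʳ b = z≤n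

    ∑-link-bound : ∀ {v y z} → Triangle v y z → ∑ (λ u → b * (a v u * a y u) + b * (a v u * a z u)) ≡ 2 * (b * b)
    ∑-link-bound {v} {y} {z} ⟨ vy , vz , yz ⟩ = begin
      ∑ (λ u → b * (a v u * a y u) + b * (a v u * a z u))
        ≡⟨ ∑-distrib-+ (λ u → b * (a v u * a y u)) (λ u → b * (a v u * a z u)) ⟩
      ∑ (λ u → b * (a v u * a y u)) + ∑ (λ u → b * (a v u * a z u))
        ≡⟨ cong₂ _+_ (*-distribˡ-sum b (λ u → a v u * a y u)) (*-distribˡ-sum b (λ u → a v u * a z u)) ⟨
      b * c v y + b * c v z
        ≡⟨ cong₂ (λ p q → b * p + b * q) (triangle⇒c≡b vy vz yz) (triangle⇒c≡b vz vy (~-sym yz)) ⟩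
      b * b + b * b
        ≡⟨ cong (b * b +_) (+-identityʳ (b * b)) ⟨
      2 * (b * b) ∎
      where open ≡-Reasoning

  triangle⇒2b²≤t : ∀ {v y z} → Triangle v y z → 2 * (b * b) ≤ t v
  triangle⇒2b²≤t tri = ≤-trans (≤-reflexive (sym (∑-link-bound tri))) (∑-mono (link-bound tri))

  private
    ∑2b² : ∑ {n} (λ _ → 2 * (b * b)) ≡ 6 * (b * b * (2 * b))
    ∑2b² = trans (∑-const n (2 * (b * b))) (rearrange b)
      where
      rearrange : ∀ b → 6 * b * (2 * (b * b)) ≡ 6 * (b * b * (2 * b))
      rearrange = solve-∀

  t≥2b²⇒numTriangles≥2b³ : (∀ v → 2 * (b * b) ≤ t v) → b * b * (2 * b) ≤ numTriangles G
  t≥2b²⇒numTriangles≥2b³ t≥ = *-cancelˡ-≤ 6 (subst₂ _≤_ ∑2b² ∑t≡6*numTriangles (∑-mono t≥))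

  t≤2b²⇒numTriangles≤2b³ : (∀ v → t v ≤ 2 * (b * b)) → numTriangles G ≤ b * b * (2 * b)
  t≤2b²⇒numTriangles≤2b³ t≤ = *-cancelˡ-≤ 6 (subst₂ _≤_ ∑t≡6*numTriangles ∑2b² (∑-mono t≤))

  numTriangles≡2b³⇒t≡2b² : (∀ v → 2 * (b * b) ≤ t v) → numTriangles G ≡ b * b * (2 * b) → ∀ v → t v ≡ 2 * (b * b)
  numTriangles≡2b³⇒t≡2b² t≥ eq v = sym (∑-tight t≥
    (≤-reflexive (trans ∑t≡6*numTriangles (trans (cong (6 *_) eq) (sym ∑2b²)))) v)

  -- Local structure when the bound is attained at every vertex.

  module Tight (t≡2b² : ∀ v → t v ≡ 2 * (b * b)) where

    -- Since t(v) = 2b², `link-bound` is an equality at w. The triangle vws makes c(vw) positive, so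
    -- the left side cannot vanish and w is adjacent to y or z.
    link-cover : ∀ {v y z w s} → Triangle v y z → Triangle v w s → y ~ w ⊎ z ~ w
    link-cover {v} {y} {z} {w} {s} tri ⟨ vw , vs , ws ⟩ = cases (G y w) (G z w) vw (common-neighbour⇒0<c vs ws)
      (∑-tight (link-bound tri) (≤-reflexive (trans (t≡2b² v) (sym (∑-link-bound tri)))) w)
      where
      cases : ∀ {p} q r {k} → p ≡ true → 0 < k → b * (𝟙 p * 𝟙 q) + b * (𝟙 p * 𝟙 r) ≡ 𝟙 p * k → q ≡ true ⊎ r ≡ true
      cases true  _     _    _         _  = inj₁ refl
      cases false true  _    _         _  = inj₂ refl
      cases false false refl (s≤s z≤n) eq rewrite *-zeroʳ b with () ← eq

    -- Let w be a neighbour of x. The triangle uyz dominates w. If y ~ w, then `link-cover` at y,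
    -- applied to yuz and ywx, gives u ~ w or z ~ w, and the latter would complete a K₄ on x, y, z,
    -- w. The case z ~ w is symmetric. Hence N(x) lies in N(u).
    twins : ∀ {x y z u} → Triangle x y z → y ~ u → z ~ u → ∀ w → G x w ≡ G u w
    twins {x} {y} {z} {u} tri@(⟨ xy , xz , yz ⟩) yu zu = nested⇒twins x⊆u
      where
      via-y : ∀ {w} → x ~ w → y ~ w → u ~ w
      via-y xw yw = [ id , (λ zw → contradiction zw (no-K₄ tri xw yw)) ]′
        (link-cover ⟨ yu , yz , ~-sym zu ⟩ ⟨ yw , ~-sym xy , ~-sym xw ⟩)
      via-z : ∀ {w} → x ~ w → z ~ w → u ~ w
      via-z xw zw = [ id , (λ yw → contradiction zw (no-K₄ tri xw yw)) ]′
        (link-cover ⟨ zu , ~-sym yz , ~-sym yu ⟩ ⟨ zw , ~-sym xz , ~-sym xw ⟩)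
      x⊆u : ∀ w → x ~ w → u ~ w
      x⊆u w xw = [ id , [ via-y xw , via-z xw ]′ ]′ (triangle-dominates ⟨ ~-sym yu , ~-sym zu , yz ⟩ w)

    -- A triangle on the edge xv would, by `link-cover` at x, make v adjacent to y or z. So x and v
    -- have disjoint neighbourhoods.
    antitwins : ∀ {x y z v} → Triangle x y z → x ~ v → ¬ y ~ v → ¬ z ~ v → ∀ w → G v w ≡ not (G x w)
    antitwins tri xv ¬yv ¬zv = disjoint⇒complementary λ w xw vw →
      [ ¬yv , ¬zv ]′ (link-cover tri ⟨ xv , xw , vw ⟩)

  -- Isomorphism with the balanced complete bipartite graph.

  bipartite⇒balanced : ∀ v → (∀ u w → G u w ≡ G v u xor G v w) → Isomorphic G (balancedBipartite (6 * b))
  bipartite⇒balanced v G≡ = proj₁ match , λ i j →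
    trans (G≡ _ _) (cong₂ _xor_ (proj₂ match i) (proj₂ match j))
    where
    left : Fin n → Bool
    left i = toℕ i <ᵇ 6 * b / 2
    halves : ∀ b → 6 * b ≡ 3 * b + 3 * b
    halves = solve-∀
    twice : ∀ b → 6 * b ≡ 3 * b * 2
    twice = solve-∀
    n/2≡3b : 6 * b / 2 ≡ 3 * b
    n/2≡3b = trans (cong (_/ 2) (twice b)) (m*n/n≡m (3 * b) 2)
    |left|≡3b : ∑ (𝟙 ∘ left) ≡ 3 * b
    |left|≡3b = trans (∑-<ᵇ (≤-trans (≤-reflexive n/2≡3b) (*-monoˡ-≤ b (m≤m+n 3 3)))) n/2≡3b
    match : Σ (Permutation′ n) λ π → ∀ i → G v (π ⟨$⟩ʳ i) ≡ left i
    -- Both Boolean functions are true at exactly 3b of the 6b vertices.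
    match = rearrangement _≟ᵇ_ (G v) left λ i → ≤-reflexive
      (trans (multiplicity-half (halves b) left |left|≡3b (left i))
             (sym (multiplicity-half (halves b) (G v) (d≡3b v) (left i))))

  -- The graph S attains the bound.

  open Parts b

  -- Of the 3b edges at a vertex, the b edges to the opposite part contribute 0 to t and the
  -- remaining 2b contribute at most b each. The proof adds b·b to t so as to compare with b·3b.
  S⇒t≤2b² : Isomorphic G (S b (6 * b)) → ∀ v → t v ≤ 2 * (b * b)
  S⇒t≤2b² (π , G≡S) v = subst (λ v → t v ≤ 2 * (b * b)) (inverseʳ π) (image (π ⟨$⟩ˡ v))
    where
    G≡joined : ∀ i j → G (π ⟨$⟩ʳ i) (π ⟨$⟩ʳ j) ≡ joined (part i) (part j)
    G≡joined i j = trans (G≡S i j) (S≡joined i j)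

    -- Edges between the two sides lie in no triangle.
    crossing : ∀ i j → part j ≡ opposite (part i) →
      G (π ⟨$⟩ʳ i) (π ⟨$⟩ʳ j) ≡ true × c (π ⟨$⟩ʳ i) (π ⟨$⟩ʳ j) ≡ 0
    crossing i j eq =
      trans (G≡joined i j) (trans (cong (joined (part i)) eq) (joined-opposite (part i))) ,
      n≤0⇒n≡0 (≮⇒≥ λ 0<c → no-common-neighbour (0<c⇒common-neighbour 0<c))
      where
      no-common-neighbour : ¬ ∃ λ w → G (π ⟨$⟩ʳ i) w ≡ true × G (π ⟨$⟩ʳ j) w ≡ true
      no-common-neighbour (w , iw , jw) = opposite-disjoint (part i) (part k)
        (trans (sym (G≡joined i k)) (trans (cong (G (π ⟨$⟩ʳ i)) (inverseʳ π)) iw))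
        (trans (cong (λ p → joined p (part k)) (sym eq))
          (trans (sym (G≡joined j k)) (trans (cong (G (π ⟨$⟩ʳ j)) (inverseʳ π)) jw)))
        where
        k : Fin n
        k = π ⟨$⟩ˡ w

    pointwise : ∀ {A : Set} {p k} (A? : Dec A) → (A → p ≡ true × k ≡ 0) → (p ≡ true → k ≤ b) →
      𝟙 p * k + b * 𝟙 (does A?) ≤ b * 𝟙 p
    pointwise (yes x) h _ with refl , refl ← h x = ≤-refl
    pointwise {p = false} (no _) _ _ = ≤-refl
    pointwise {p = true} {k} (no _) _ h rewrite *-zeroʳ b | *-identityʳ b | +-identityʳ (k + 0) | +-identityʳ k = h refl

    image : ∀ i → t (π ⟨$⟩ʳ i) ≤ 2 * (b * b)
    image i = +-cancelʳ-≤ (b * b) _ _ (begin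
      t v′ + b * b
        ≡⟨ cong₂ _+_ (sum-permute F π) (cong (b *_) (sym (multiplicity-part (opposite (part i))))) ⟩
      ∑ (λ j → F (π ⟨$⟩ʳ j)) + b * multiplicity _≟ₚ_ part (opposite (part i))
        ≡⟨ cong (∑ (λ j → F (π ⟨$⟩ʳ j)) +_) (*-distribˡ-sum b X) ⟩
      ∑ (λ j → F (π ⟨$⟩ʳ j)) + ∑ (λ j → b * X j)
        ≡⟨ ∑-distrib-+ (λ j → F (π ⟨$⟩ʳ j)) (λ j → b * X j) ⟨
      ∑ (λ j → F (π ⟨$⟩ʳ j) + b * X j)
        ≤⟨ ∑-mono (λ j → pointwise (part j ≟ₚ opposite (part i)) (crossing i j) c≤b) ⟩
      ∑ (λ j → b * a v′ (π ⟨$⟩ʳ j))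
        ≡⟨ *-distribˡ-sum b (λ j → a v′ (π ⟨$⟩ʳ j)) ⟨
      b * ∑ (λ j → a v′ (π ⟨$⟩ʳ j))
        ≡⟨ cong (b *_) (trans (sym (sum-permute (a v′) π)) (d≡3b v′)) ⟩
      b * (3 * b)
        ≡⟨ three b ⟩
      2 * (b * b) + b * b ∎)
      where
      open ≤-Reasoning
      v′ : Fin n
      v′ = π ⟨$⟩ʳ i
      F X : Fin n → ℕ
      F u = a v′ u * c v′ u
      X j = 𝟙 (does (part j ≟ₚ opposite (part i)))
      three : ∀ b → b * (3 * b) ≡ 2 * (b * b) + b * b
      three = solve-∀

  -- Recovering S from a single triangle.

  module Reconstruction (t≡2b² : ∀ v → t v ≡ 2 * (b * b)) {x y z} (xyz : Triangle x y z) where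

    open Tight t≡2b²

    τ : Fin 3 → Fin n
    τ zero             = x
    τ (suc zero)       = y
    τ (suc (suc zero)) = z

    -- Rotating the triangle lets the arguments about x be reused for y and z.
    next : Fin 3 → Fin 3
    next zero             = suc zero
    next (suc zero)       = suc (suc zero)
    next (suc (suc zero)) = zero

    τ-triangle : ∀ i → Triangle (τ i) (τ (next i)) (τ (next (next i)))
    τ-triangle zero             = xyz
    τ-triangle (suc zero)       = let ⟨ xy , xz , yz ⟩ = xyz in ⟨ yz , ~-sym xy , ~-sym xz ⟩
    τ-triangle (suc (suc zero)) = let ⟨ xy , xz , yz ⟩ = xyz in ⟨ ~-sym xz , ~-sym yz , xy ⟩

    -- The last two values are junk: every vertex is adjacent to one or two of x, y, z.
    classify : Bool → Bool → Bool → Part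
    classify false true  true  = true , zero
    classify true  false true  = true , suc zero
    classify true  true  false = true , suc (suc zero)
    classify true  false false = false , zero
    classify false true  false = false , suc zero
    classify false false true  = false , suc (suc zero)
    classify false false false = true , zero
    classify true  true  true  = true , zero

    classify-cong : ∀ {p q r p′ q′ r′} → p ≡ p′ → q ≡ q′ → r ≡ r′ → classify p q r ≡ classify p′ q′ r′
    classify-cong refl refl refl = refl

    -- A vertex of class (true , i) misses only `τ i` among x, y, z, and one of class (false , i)
    -- meets only `τ i`. In particular `τ i` itself has class (true , i).
    adjacent-to-τ : Part → Fin 3 → Bool
    adjacent-to-τ (s , i) j = s xor (toℕ j ≡ᵇ toℕ i)

    class : Fin n → Part
    class w = classify (G x w) (G y w) (G z w)

    -- Domination excludes the pattern with no adjacency and the absence of K₄ the one with three;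
    -- on the other six patterns the class determines the three adjacencies.
    G-τ : ∀ j w → G (τ j) w ≡ adjacent-to-τ (class w) j
    G-τ j w = select j (table (G x w) (G y w) (G z w) (triangle-dominates xyz w) (no-K₄ xyz))
      where
      Agrees : Bool → Bool → Bool → Set
      Agrees p q r = (p ≡ adjacent-to-τ (classify p q r) zero)
                   × (q ≡ adjacent-to-τ (classify p q r) (suc zero))
                   × (r ≡ adjacent-to-τ (classify p q r) (suc (suc zero)))
      table : ∀ p q r → p ≡ true ⊎ q ≡ true ⊎ r ≡ true → (p ≡ true → q ≡ true → ¬ r ≡ true) → Agrees p q r
      table false false false (inj₁ ()) _
      table false false false (inj₂ (inj₁ ())) _
      table false false false (inj₂ (inj₂ ())) _
      table false false true  _ _ = refl , refl , refl
      table false true  false _ _ = refl , refl , refl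
      table false true  true  _ _ = refl , refl , refl
      table true  false false _ _ = refl , refl , refl
      table true  false true  _ _ = refl , refl , refl
      table true  true  false _ _ = refl , refl , refl
      table true  true  true  _ h = contradiction refl (h refl refl)
      select : ∀ j → Agrees (G x w) (G y w) (G z w) → G (τ j) w ≡ adjacent-to-τ (class w) j
      select zero             (p , _ , _) = p
      select (suc zero)       (_ , q , _) = q
      select (suc (suc zero)) (_ , _ , r) = r

    class≡U : ∀ i {w} → G (τ i) w ≡ false → G (τ (next i)) w ≡ true → G (τ (next (next i))) w ≡ true → class w ≡ (true , i)
    class≡U zero             p q r = classify-cong p q r
    class≡U (suc zero)       p q r = classify-cong r p q
    class≡U (suc (suc zero)) p q r = classify-cong q r p

    class≡V : ∀ i {w} → G (τ i) w ≡ true → G (τ (next i)) w ≡ false → G (τ (next (next i))) w ≡ false → class w ≡ (false , i)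
    class≡V zero             p q r = classify-cong p q r
    class≡V (suc zero)       p q r = classify-cong r p q
    class≡V (suc (suc zero)) p q r = classify-cong q r p

    -- A vertex of class (true , i) is a twin of `τ i` and one of class (false , i) has the
    -- complementary neighbourhood. Adjacency to u is thus adjacency to `τ i` or its negation, which
    -- the class of w encodes.
    G-class : ∀ p {u} → class u ≡ p → ∀ w → G u w ≡ joined p (class w)
    G-class (s , i) {u} class≡ w = trans (cases s (λ j → trans (G-τ j u) (cong (λ p → adjacent-to-τ p j) class≡)))
                                         (flip-side s (class w))
      where
      next-≢ : ∀ i → (toℕ (next i) ≡ᵇ toℕ i) ≡ false
      next-≢ zero             = refl
      next-≢ (suc zero)       = refl
      next-≢ (suc (suc zero)) = refl
      next²-≢ : ∀ i → (toℕ (next (next i)) ≡ᵇ toℕ i) ≡ false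
      next²-≢ zero             = refl
      next²-≢ (suc zero)       = refl
      next²-≢ (suc (suc zero)) = refl
      ≡ᵇ-refl : ∀ (i : Fin 3) → (toℕ i ≡ᵇ toℕ i) ≡ true
      ≡ᵇ-refl zero             = refl
      ≡ᵇ-refl (suc zero)       = refl
      ≡ᵇ-refl (suc (suc zero)) = refl
      cases : ∀ s → (∀ j → G (τ j) u ≡ adjacent-to-τ (s , i) j) → G u w ≡ not s xor adjacent-to-τ (class w) i
      cases true bits = trans (sym (twins (τ-triangle i)
          (trans (bits (next i)) (cong not (next-≢ i)))
          (trans (bits (next (next i))) (cong not (next²-≢ i))) w))
        (G-τ i w)
      cases false bits = trans (antitwins (τ-triangle i)
          (trans (bits i) (≡ᵇ-refl i))
          (λ e → true≢false e (trans (bits (next i)) (next-≢ i)))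
          (λ e → true≢false e (trans (bits (next (next i))) (next²-≢ i))) w)
        (cong not (G-τ i w))
      flip-side : ∀ s q → not s xor adjacent-to-τ q i ≡ joined (s , i) q
      flip-side s (s′ , i′) = table s s′ (toℕ i ≡ᵇ toℕ i′)
        where
        table : ∀ s s′ e → not s xor (s′ xor e) ≡ (not (s xor s′) ∧ not e) ∨ (not (not (s xor s′)) ∧ e)
        table false false false = refl
        table false false true  = refl
        table false true  false = refl
        table false true  true  = refl
        table true  false false = refl
        table true  false true  = refl
        table true  true  false = refl
        table true  true  true  = refl

    -- Class (true , i) contains the b common neighbours of the other two triangle vertices. Class
    -- (false , i) contains what is left of the 3b neighbours of `τ i` after removing the b shared
    -- with each of those two. Lower bounds are all that `rearrangement` asks for.
    b≤multiplicity-class : ∀ p → b ≤ multiplicity _≟ₚ_ class p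
    b≤multiplicity-class (true , i) = ≤-trans (≤-reflexive (sym (triangle⇒c≡b vw (~-sym uv) (~-sym uw))))
      (∑-mono λ w → pointwise (G (τ (next i)) w) (G (τ (next (next i))) w) λ q r →
        ≤-reflexive (sym (𝟙-≡ _≟ₚ_ (class≡U i (¬-not λ p → no-K₄ (τ-triangle i) p q r) q r))))
      where
      open Triangle (τ-triangle i)
      pointwise : ∀ q r {k} → (q ≡ true → r ≡ true → 1 ≤ k) → 𝟙 q * 𝟙 r ≤ k
      pointwise false _     _ = z≤n
      pointwise true  false _ = z≤n
      pointwise true  true  h = h refl refl
    b≤multiplicity-class (false , i) = +-cancelˡ-≤ (b + b) _ _ (begin
      (b + b) + b
        ≡⟨ three b ⟩
      3 * b
        ≡⟨ d≡3b u ⟨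
      d u
        ≤⟨ ∑-mono (λ w → pointwise (G u w) (G v w) (G v′ w) (λ p q r → ≤-reflexive (sym (𝟙-≡ _≟ₚ_ (class≡V i p q r))))) ⟩
      ∑ (λ w → (a u w * a v w + a u w * a v′ w) + 𝟙 (does (class w ≟ₚ (false , i))))
        ≡⟨ ∑-distrib-+ (λ w → a u w * a v w + a u w * a v′ w) (λ w → 𝟙 (does (class w ≟ₚ (false , i)))) ⟩
      ∑ (λ w → a u w * a v w + a u w * a v′ w) + multiplicity _≟ₚ_ class (false , i)
        ≡⟨ cong (_+ multiplicity _≟ₚ_ class (false , i)) (trans (∑-distrib-+ (λ w → a u w * a v w) (λ w → a u w * a v′ w))
             (cong₂ _+_ (triangle⇒c≡b uv uw vw) (triangle⇒c≡b uw uv (~-sym vw)))) ⟩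
      (b + b) + multiplicity _≟ₚ_ class (false , i) ∎)
      where
      open ≤-Reasoning
      open Triangle (τ-triangle i)
      u v v′ : Fin n
      u  = τ i
      v  = τ (next i)
      v′ = τ (next (next i))
      three : ∀ b → (b + b) + b ≡ 3 * b
      three = solve-∀
      pointwise : ∀ p q r {k} → (p ≡ true → q ≡ false → r ≡ false → 1 ≤ k) → 𝟙 p ≤ (𝟙 p * 𝟙 q + 𝟙 p * 𝟙 r) + k
      pointwise false _     _     _ = z≤n
      pointwise true  true  _     _ = s≤s z≤n
      pointwise true  false true  _ = s≤s z≤n
      pointwise true  false false h = h refl refl refl

    isomorphic-to-S : Isomorphic G (S b (6 * b))
    isomorphic-to-S = proj₁ match , λ i j → trans (G-class _ refl _)
      (trans (cong₂ joined (proj₂ match i) (proj₂ match j)) (sym (S≡joined i j)))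
      where
      match : Σ (Permutation′ n) λ π → ∀ i → class (π ⟨$⟩ʳ i) ≡ part i
      match = rearrangement _≟ₚ_ class part λ i →
        ≤-trans (≤-reflexive (multiplicity-part (part i))) (b≤multiplicity-class (part i))

-- Assembling the bound and the equality case.

theorem-6b : ∀ b → 0 < 6 * b → (G : Adj (6 * b)) → IsSimpleGraph G →
  6 * b * (6 * b) ≤ 4 * numEdges G → bookNumber G ≤ b → ¬ Isomorphic G (balancedBipartite (6 * b)) →
  (b * b * (6 * b ∸ 4 * b) ≤ numTriangles G)
  × ((numTriangles G ≡ b * b * (6 * b ∸ 4 * b)) ⇔ Isomorphic G (S b (6 * b)))
theorem-6b b 0<6b G simple dense book not-balanced =
  ≤-trans (≤-reflexive bound≡) lower-bound , mk⇔ to from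
  where
  bound≡ : b * b * (6 * b ∸ 4 * b) ≡ b * b * (2 * b)
  bound≡ = cong (b * b *_) (sym (*-distribʳ-∸ b 6 4))
  open Extremal b (*-cancelˡ-< 6 0 b 0<6b) G simple dense book
  in-triangle : ∀ v → ∃ λ u → ∃ λ w → Triangle v u w
  in-triangle v = [ id , (λ G≡ → contradiction (bipartite⇒balanced v G≡) not-balanced) ]′ (triangle-or-bipartite v)
  t≥2b² : ∀ v → 2 * (b * b) ≤ t v
  t≥2b² v = triangle⇒2b²≤t (proj₂ (proj₂ (in-triangle v)))
  lower-bound : b * b * (2 * b) ≤ numTriangles G
  lower-bound = t≥2b²⇒numTriangles≥2b³ t≥2b²
  to : numTriangles G ≡ b * b * (6 * b ∸ 4 * b) → Isomorphic G (S b (6 * b))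
  -- Every vertex lies in a triangle, so any vertex will do; `0<6b` supplies vertex 0.
  to eq = Reconstruction.isomorphic-to-S (numTriangles≡2b³⇒t≡2b² t≥2b² (trans eq bound≡)) (proj₂ (proj₂ (in-triangle (fromℕ< 0<6b))))
  from : Isomorphic G (S b (6 * b)) → numTriangles G ≡ b * b * (6 * b ∸ 4 * b)
  from iso = trans (≤-antisym (t≤2b²⇒numTriangles≤2b³ (S⇒t≤2b² iso)) lower-bound) (sym bound≡)

theorem1p3 : (n : ℕ) → 0 < n → 6 ∣ n →
    (G : Adj n) → IsSimpleGraph G →
    n * n ≤ 4 * numEdges G →
    bookNumber G ≤ n / 6 →
    ¬ Isomorphic G (balancedBipartite n) →
    ((n / 6) * (n / 6) * (n ∸ 4 * (n / 6)) ≤ numTriangles G)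
    × ((numTriangles G ≡ (n / 6) * (n / 6) * (n ∸ 4 * (n / 6)))
    ⇔ Isomorphic G (S (n / 6) n))
theorem1p3 n 0<n (divides b n≡b*6) with refl ← trans n≡b*6 (*-comm b 6)
  rewrite trans (cong (_/ 6) (*-comm 6 b)) (m*n/n≡m b 6) = theorem-6b b 0<n
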